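{- Let $G$ be a weakly connected oriented graph on $n\ge 2$ vertices with $m\ge 1$ edges, with non-zero edge weights in $\mathbb{C}\setminus\mathbb{R}^-$, and let $N$ be its complex signless incidence matrix. Then $\operatorname{rank}(N)=n-1$ if and only if either $G$ is a tree, or $wt(C)\in\mathbb{R}^+$ for all even cycles $C$ of $G$ and $wt(C)\in\mathbb{R}^-$ for all odd cycles $C$ of $G$.
   Context: An oriented graph $G$ is obtained from a finite simple undirected graph $G_u$ (its underlying graph) by giving each edge exactly one direction; it is weakly connected if $G_u$ is connected, and it is called a tree if $G_u$ is a tree. Write $V(G)=\{1,\dots,n\}$ and $E(G)=\{e_1,\dots,e_m\}$. Each directed edge $(u,v)$ (from $u$ to $v$) has a non-zero complex weight $w_{uv}$. $\mathbb{R}^+$ and $\mathbb{R}^-$ denote the positive and the negative real numbers, and $\sqrt{\cdot}$ is the principal square root. The complex signless incidence matrix of $G$ is the $n\times m$ matrix $N=(n_{ij})$ where, for $e_j=(u,v)$, $n_{ij}=\sqrt{w_{uv}}$ if $i=u$, $n_{ij}=\sqrt{\overline{w_{uv}}}$ if $i=v$, and $n_{ij}=0$ otherwise. Put $a_{ij}=w_{ij}$ if $(i,j)\in E(G)$, $a_{ij}=\overline{w_{ji}}$ if $(j,i)\in E(G)$, and $a_{ij}=0$ otherwise. The weight of a walk $\gamma=(i_1,\dots,i_k)$ in $G_u$ is $wt(\gamma)=\prod_{s=1}^{k-1}a_{i_si_{s+1}}$. A cycle of $G$ means a cycle of $G_u$ (even or odd according to its length); $wt(C)$ is the weight of the closed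 walk going once around $C$ in either direction. The two directions give complex conjugate values, so the conditions $wt(C)\in\mathbb{R}^{\pm}$ do not depend on the choice. -}

module Defs where

open import Algebra.Bundles using (CommutativeRing)
open import Algebra.Core using (Op₁; Op₂)
open import Algebra.Structures using (IsCommutativeRing)
open import Data.Fin.Base using (Fin)
open import Data.Fin.Properties using (_≟_; any?)
open import Data.List.Base as List using (List; []; _∷_; _∷ʳ_)
open import Data.List.Relation.Unary.Linked using (Linked)
open import Data.List.Relation.Unary.Unique.Propositional using (Unique)
open import Data.Nat.Base as ℕ using (ℕ)
open import Data.Nat.Divisibility using (_∣_)
open import Data.Product using (∃; _×_; _,_; proj₁; proj₂)
open import Data.Sum using (_⊎_; inj₁; inj₂)
open import Data.Vec.Functional using (Vector; transpose)
open import Level using () renaming (suc to lsuc)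
open import Relation.Binary.Bundles using (DecTotalOrder)
open import Relation.Binary.Core using (Rel)
open import Relation.Binary.Construct.Closure.ReflexiveTransitive using (Star)
open import Relation.Binary.PropositionalEquality using (_≡_; _≢_)
open import Relation.Binary.Structures using (IsDecTotalOrder)
open import Relation.Nullary using (¬_; Dec; yes; no)
open import Relation.Nullary.Decidable using (_×-dec_)
open import Relation.Unary using (Pred)

import Algebra.Properties.Ring as RingProperties
import Algebra.Solver.Ring.NaturalCoefficients.Default as SemiringSolver
import Algebra.Definitions.RawMonoid as RawMonoidDefinitions
import Relation.Binary.Properties.DecTotalOrder as DecTotalOrderProperties
import Relation.Binary.Reasoning.Setoid as SetoidReasoning

-- The library has no real numbers, so they enter through the axioms of a
-- Dedekind-complete ordered field, which determine ℝ up to unique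
-- isomorphism.  The order is the classical one: it is decidable and every
-- inhabited subset that is bounded above has a supremum.
-- The value of x ⁻¹ at x ≈ 0# is unconstrained.
record Reals ℓ : Set (lsuc ℓ) where
  infix  8 _⁻¹
  infix  8 -_
  infixl 7 _*_
  infixl 6 _+_
  infix  4 _≈_ _≤_
  field
    Carrier : Set ℓ
    _≈_     : Rel Carrier ℓ
    _≤_     : Rel Carrier ℓ
    _+_     : Op₂ Carrier
    _*_     : Op₂ Carrier
    -_      : Op₁ Carrier
    _⁻¹     : Op₁ Carrier
    0#      : Carrier
    1#      : Carrier

    isCommutativeRing : IsCommutativeRing _≈_ _+_ _*_ -_ 0# 1#
    0≉1               : ¬ 0# ≈ 1#
    *-inverseʳ        : ∀ x → ¬ x ≈ 0# → x * x ⁻¹ ≈ 1#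

    isDecTotalOrder   : IsDecTotalOrder _≈_ _≤_
    +-monoˡ-≤         : ∀ {x y} z → x ≤ y → x + z ≤ y + z
    *-nonneg          : ∀ {x y} → 0# ≤ x → 0# ≤ y → 0# ≤ x * y

  IsUpperBound : Pred Carrier ℓ → Pred Carrier ℓ
  IsUpperBound P u = ∀ x → P x → x ≤ u

  field
    supremum : (P : Pred Carrier ℓ) → ∃ P → ∃ (IsUpperBound P) →
               ∃ λ s → IsUpperBound P s × (∀ u → IsUpperBound P u → s ≤ u)

  commutativeRing : CommutativeRing ℓ ℓ
  commutativeRing = record { isCommutativeRing = isCommutativeRing }

  decTotalOrder : DecTotalOrder ℓ ℓ ℓ
  decTotalOrder = record { isDecTotalOrder = isDecTotalOrder }

  open CommutativeRing commutativeRing public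
    hiding (Carrier; _≈_; _+_; _*_; -_; 0#; 1#; isCommutativeRing)
  open IsDecTotalOrder isDecTotalOrder public
    using (_≤?_; total; antisym; ≤-respˡ-≈; ≤-respʳ-≈)
    renaming (_≟_ to _≈?_; refl to ≤-refl; reflexive to ≤-reflexive;
              trans to ≤-trans)
  open DecTotalOrderProperties decTotalOrder public
    using (_<_; <⇒≉; ≤∧≉⇒<; <⇒≱; ≰⇒>; ≰⇒≥; <-respʳ-≈; <-respˡ-≈; <-irrefl)

module RealSqrt {ℓ} (ℝ : Reals ℓ) where
  open Reals ℝ
  open RingProperties ring using (-‿distribˡ-*; -‿distribʳ-*; -‿involutive; +-cancelʳ)
  open SemiringSolver commutativeSemiring using (solve; _:+_; _:*_; _:=_; con)

  +-mono-≤ : ∀ {x y u v} → x ≤ y → u ≤ v → x + u ≤ y + v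
  +-mono-≤ {x} {y} {u} {v} x≤y u≤v = ≤-trans (+-monoˡ-≤ u x≤y)
    (≤-respˡ-≈ (+-comm u y) (≤-respʳ-≈ (+-comm v y) (+-monoˡ-≤ y u≤v)))

  +-nonneg : ∀ {x y} → 0# ≤ x → 0# ≤ y → 0# ≤ x + y
  +-nonneg 0≤x 0≤y = ≤-respˡ-≈ (+-identityˡ 0#) (+-mono-≤ 0≤x 0≤y)

  x≤x+d : ∀ x {d} → 0# ≤ d → x ≤ x + d
  x≤x+d x 0≤d = ≤-respˡ-≈ (+-identityʳ x) (+-mono-≤ ≤-refl 0≤d)

  ≤⇒∃d : ∀ {x y} → x ≤ y → ∃ λ d → 0# ≤ d × y ≈ x + d
  ≤⇒∃d {x} {y} x≤y = y + - x
    , ≤-respˡ-≈ (-‿inverseʳ x) (+-monoˡ-≤ (- x) x≤y)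
    , sym (begin
        x + (y + - x)  ≈⟨ solve 3 (λ x y m → x :+ (y :+ m) := (x :+ m) :+ y) refl x y (- x) ⟩
        (x + - x) + y  ≈⟨ +-congʳ (-‿inverseʳ x) ⟩
        0# + y         ≈⟨ +-identityˡ y ⟩
        y              ∎)
    where open SetoidReasoning setoid

  +-cancelˡ-≤0 : ∀ x {d} → x + d ≤ x → d ≤ 0#
  +-cancelˡ-≤0 x {d} le = ≤-respʳ-≈ (-‿inverseʳ x) (≤-respˡ-≈ (begin
    (x + d) + - x  ≈⟨ solve 3 (λ x d m → (x :+ d) :+ m := d :+ (x :+ m)) refl x d (- x) ⟩
    d + (x + - x)  ≈⟨ +-congˡ (-‿inverseʳ x) ⟩
    d + 0#         ≈⟨ +-identityʳ d ⟩
    d              ∎) (+-monoˡ-≤ (- x) le))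
    where open SetoidReasoning setoid

  ≤0⇒0≤- : ∀ {x} → x ≤ 0# → 0# ≤ - x
  ≤0⇒0≤- {x} x≤0 =
    ≤-respˡ-≈ (-‿inverseʳ x) (≤-respʳ-≈ (+-identityˡ (- x)) (+-monoˡ-≤ (- x) x≤0))

  -x*-x≈x*x : ∀ x → - x * - x ≈ x * x
  -x*-x≈x*x x = trans (sym (-‿distribˡ-* x (- x)))
    (trans (-‿cong (sym (-‿distribʳ-* x x))) (-‿involutive (x * x)))

  sq-nonneg : ∀ x → 0# ≤ x * x
  sq-nonneg x with total 0# x
  ... | inj₁ 0≤x = *-nonneg 0≤x 0≤x
  ... | inj₂ x≤0 = ≤-respʳ-≈ (-x*-x≈x*x x) (*-nonneg (≤0⇒0≤- x≤0) (≤0⇒0≤- x≤0))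

  0≤1 : 0# ≤ 1#
  0≤1 = ≤-respʳ-≈ (*-identityʳ 1#) (sq-nonneg 1#)

  x*y≈0⇒x≈0 : ∀ {x y} → x * y ≈ 0# → ¬ y ≈ 0# → x ≈ 0#
  x*y≈0⇒x≈0 {x} {y} xy≈0 y≉0 = begin
    x               ≈⟨ *-identityʳ x ⟨
    x * 1#          ≈⟨ *-congˡ (*-inverseʳ y y≉0) ⟨
    x * (y * y ⁻¹)  ≈⟨ *-assoc x y (y ⁻¹) ⟨
    (x * y) * y ⁻¹  ≈⟨ *-congʳ xy≈0 ⟩
    0# * y ⁻¹       ≈⟨ zeroˡ (y ⁻¹) ⟩
    0#              ∎
    where open SetoidReasoning setoid

  x*x≈0⇒x≈0 : ∀ {x} → x * x ≈ 0# → x ≈ 0#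
  x*x≈0⇒x≈0 {x} xx≈0 with x ≈? 0#
  ... | yes x≈0 = x≈0
  ... | no  x≉0 = x*y≈0⇒x≈0 xx≈0 x≉0

  ⁻¹-nonneg : ∀ {x} → 0# ≤ x → ¬ x ≈ 0# → 0# ≤ x ⁻¹
  ⁻¹-nonneg {x} 0≤x x≉0 = ≤-respʳ-≈ (begin
    x * (x ⁻¹ * x ⁻¹)  ≈⟨ *-assoc x _ _ ⟨
    (x * x ⁻¹) * x ⁻¹  ≈⟨ *-congʳ (*-inverseʳ x x≉0) ⟩
    1# * x ⁻¹          ≈⟨ *-identityˡ _ ⟩
    x ⁻¹               ∎) (*-nonneg 0≤x (sq-nonneg (x ⁻¹)))
    where open SetoidReasoning setoid

  1+x≉0 : ∀ {x} → 0# ≤ x → ¬ x + 1# ≈ 0#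
  1+x≉0 {x} 0≤x eq = 0≉1 (antisym 0≤1
    (≤-respˡ-≈ (+-identityˡ 1#) (≤-respʳ-≈ eq (+-monoˡ-≤ 1# 0≤x))))

  sq-reflects-≤ : ∀ {x y} → 0# ≤ y → x * x ≤ y * y → x ≤ y
  sq-reflects-≤ {x} {y} 0≤y xx≤yy with total x y
  ... | inj₁ x≤y = x≤y
  ... | inj₂ y≤x with ≤⇒∃d y≤x
  ...   | d , 0≤d , x≈y+d = ≤-reflexive (begin
      x       ≈⟨ x≈y+d ⟩
      y + d   ≈⟨ +-congˡ d≈0 ⟩
      y + 0#  ≈⟨ +-identityʳ y ⟩
      y       ∎)
    where
    open SetoidReasoning setoid
    expand : x * x ≈ y * y + ((y * d + y * d) + d * d)
    expand = trans (*-cong x≈y+d x≈y+d)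
      (solve 2 (λ y d → (y :+ d) :* (y :+ d) := y :* y :+ ((y :* d :+ y :* d) :+ d :* d)) refl y d)
    0≤yd : 0# ≤ y * d
    0≤yd = *-nonneg 0≤y 0≤d
    dd≤0 : d * d ≤ 0#
    dd≤0 = ≤-trans
      (≤-respʳ-≈ (+-comm _ _) (x≤x+d (d * d) (+-nonneg 0≤yd 0≤yd)))
      (+-cancelˡ-≤0 (y * y) (≤-respˡ-≈ expand xx≤yy))
    d≈0 : d ≈ 0#
    d≈0 = x*x≈0⇒x≈0 (antisym dd≤0 (sq-nonneg d))

  -- The supremum s of {x | x² ≤ a} has s² ≈ a: otherwise
  -- u = (s(a+1)+a)/(s+a+1), which satisfies u - s = (a-s²)/(s+a+1) and
  -- u² - a = (s²-a)(a²+a+1)/(s+a+1)², contradicts the choice of s.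
  module Supremum
    {a} (0≤a : 0# ≤ a) (s : Carrier)
    (s-bound : IsUpperBound (λ x → x * x ≤ a) s)
    (s-least : ∀ u → IsUpperBound (λ x → x * x ≤ a) u → s ≤ u)
    where
    P : Pred Carrier ℓ
    P x = x * x ≤ a

    0≤s : 0# ≤ s
    0≤s = s-bound 0# (≤-respˡ-≈ (sym (zeroˡ 0#)) 0≤a)

    private
      K = a * a + a + 1#
      D = s + a + 1#
      X = s * (a + 1#) + a
      u = X * D ⁻¹

      0≤K : 0# ≤ K
      0≤K = +-nonneg (+-nonneg (*-nonneg 0≤a 0≤a) 0≤a) 0≤1

      D≉0 : ¬ D ≈ 0#
      D≉0 = 1+x≉0 (+-nonneg 0≤s 0≤a)

      0≤D : 0# ≤ D
      0≤D = +-nonneg (+-nonneg 0≤s 0≤a) 0≤1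

      0≤D⁻¹ : 0# ≤ D ⁻¹
      0≤D⁻¹ = ⁻¹-nonneg 0≤D D≉0

      0≤u : 0# ≤ u
      0≤u = *-nonneg (+-nonneg (*-nonneg 0≤s (+-nonneg 0≤a 0≤1)) 0≤a) 0≤D⁻¹

      open SetoidReasoning setoid

      cancelD : ∀ x → x * D * D ⁻¹ ≈ x
      cancelD x = trans (*-assoc x D _)
        (trans (*-congˡ (*-inverseʳ D D≉0)) (*-identityʳ x))

      cancelD² : ∀ x → x * (D * D) * (D ⁻¹ * D ⁻¹) ≈ x
      cancelD² x = begin
        x * (D * D) * (D ⁻¹ * D ⁻¹)
          ≈⟨ solve 3 (λ x D i → x :* (D :* D) :* (i :* i) := x :* D :* i :* D :* i) refl x D (D ⁻¹) ⟩
        x * D * D ⁻¹ * D * D ⁻¹      ≈⟨ cancelD (x * D * D ⁻¹) ⟩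
        x * D * D ⁻¹                 ≈⟨ cancelD x ⟩
        x                            ∎

      quotient≤0 : ∀ {d} → 0# ≤ d → d * D ⁻¹ ≤ 0# → d ≈ 0#
      quotient≤0 {d} 0≤d q≤0 = x*y≈0⇒x≈0 (antisym q≤0 (*-nonneg 0≤d 0≤D⁻¹))
        (λ D⁻¹≈0 → 0≉1 (sym (trans (sym (*-inverseʳ D D≉0))
          (trans (*-congˡ D⁻¹≈0) (zeroʳ D)))))

      t = a + 1#

      D≈ : D ≈ s + t
      D≈ = +-assoc s a 1#

      sD≈ : s * D ≈ s * s + s * t
      sD≈ = trans (*-congˡ D≈) (distribˡ s s t)

      D²≈ : D * D ≈ (s * s + (s * t + s * t)) + (K + a)
      D²≈ = begin
        D * D                                  ≈⟨ *-cong D≈ D≈ ⟩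
        (s + t) * (s + t)
          ≈⟨ solve 2 (λ s t → (s :+ t) :* (s :+ t)
               := (s :* s :+ (s :* t :+ s :* t)) :+ t :* t) refl s t ⟩
        (s * s + (s * t + s * t)) + t * t
          ≈⟨ +-congˡ (solve 1 (λ a → (a :+ con 1) :* (a :+ con 1)
               := (a :* a :+ a :+ con 1) :+ a) refl a) ⟩
        (s * s + (s * t + s * t)) + (K + a)    ∎

      below : s * s ≤ a → s * s ≈ a
      below ss≤a with ≤⇒∃d ss≤a
      ... | d , 0≤d , a≈ss+d =
        sym (trans a≈ss+d (trans (+-congˡ (quotient≤0 0≤d q≤0)) (+-identityʳ (s * s))))
        where
        X≈ : X ≈ s * D + d
        X≈ = begin
          s * (a + 1#) + a              ≈⟨ +-congˡ a≈ss+d ⟩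
          s * (a + 1#) + (s * s + d)    ≈⟨ solve 3 (λ s t d →
            s :* t :+ (s :* s :+ d) := s :* (s :+ t) :+ d) refl s (a + 1#) d ⟩
          s * (s + (a + 1#)) + d        ≈⟨ +-congʳ (*-congˡ D≈) ⟨
          s * D + d                     ∎
        u≈ : u ≈ s + d * D ⁻¹
        u≈ = trans (*-congʳ X≈) (trans (distribʳ _ _ _) (+-congʳ (cancelD s)))
        DD≈ : D * D ≈ (s * D + s * D) + (K + d)
        DD≈ = begin
          D * D                                    ≈⟨ D²≈ ⟩
          (s * s + (s * t + s * t)) + (K + a)      ≈⟨ +-congˡ (+-congˡ a≈ss+d) ⟩
          (s * s + (s * t + s * t)) + (K + (s * s + d))
            ≈⟨ solve 4 (λ ss st K d → (ss :+ (st :+ st)) :+ (K :+ (ss :+ d))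
                 := ((ss :+ st) :+ (ss :+ st)) :+ (K :+ d)) refl (s * s) (s * t) K d ⟩
          ((s * s + s * t) + (s * s + s * t)) + (K + d)
            ≈⟨ +-congʳ (+-cong sD≈ sD≈) ⟨
          (s * D + s * D) + (K + d)                ∎
        aDD≈ : X * X + d * K ≈ a * (D * D)
        aDD≈ = begin
          X * X + d * K                        ≈⟨ +-congʳ (*-cong X≈ X≈) ⟩
          (s * D + d) * (s * D + d) + d * K
            ≈⟨ solve 3 (λ y d K → (y :+ d) :* (y :+ d) :+ d :* K
                 := y :* y :+ d :* ((y :+ y) :+ (K :+ d))) refl (s * D) d K ⟩
          s * D * (s * D) + d * ((s * D + s * D) + (K + d))
            ≈⟨ +-congˡ (*-congˡ DD≈) ⟨
          s * D * (s * D) + d * (D * D)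
            ≈⟨ solve 3 (λ s D d → s :* D :* (s :* D) :+ d :* (D :* D)
                 := (s :* s :+ d) :* (D :* D)) refl s D d ⟩
          (s * s + d) * (D * D)                ≈⟨ *-congʳ a≈ss+d ⟨
          a * (D * D)                          ∎
        a≈ : u * u + d * K * (D ⁻¹ * D ⁻¹) ≈ a
        a≈ = begin
          u * u + d * K * (D ⁻¹ * D ⁻¹)
            ≈⟨ solve 3 (λ X i e → (X :* i) :* (X :* i) :+ e :* (i :* i)
                                  := (X :* X :+ e) :* (i :* i)) refl X (D ⁻¹) (d * K) ⟩
          (X * X + d * K) * (D ⁻¹ * D ⁻¹)  ≈⟨ *-congʳ aDD≈ ⟩
          a * (D * D) * (D ⁻¹ * D ⁻¹)      ≈⟨ cancelD² a ⟩
          a                                ∎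
        u∈P : P u
        u∈P = ≤-respʳ-≈ a≈ (x≤x+d (u * u)
          (*-nonneg (*-nonneg 0≤d 0≤K) (sq-nonneg (D ⁻¹))))
        q≤0 : d * D ⁻¹ ≤ 0#
        q≤0 = +-cancelˡ-≤0 s (≤-respˡ-≈ u≈ (s-bound u u∈P))

      above : a ≤ s * s → s * s ≈ a
      above a≤ss with ≤⇒∃d a≤ss
      ... | d , 0≤d , ss≈a+d =
        trans ss≈a+d (trans (+-congˡ (quotient≤0 0≤d q≤0)) (+-identityʳ a))
        where
        sD≈X+d : s * D ≈ X + d
        sD≈X+d = begin
          s * D                   ≈⟨ sD≈ ⟩
          s * s + s * t           ≈⟨ +-comm _ _ ⟩
          s * t + s * s           ≈⟨ +-congˡ ss≈a+d ⟩
          s * t + (a + d)         ≈⟨ +-assoc _ a d ⟨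
          X + d                   ∎
        s≈ : s ≈ u + d * D ⁻¹
        s≈ = trans (sym (cancelD s)) (trans (*-congʳ sD≈X+d) (distribʳ _ _ _))
        DD≈ : D * D + d ≈ ((X + d) + (X + d)) + K
        DD≈ = begin
          D * D + d                                      ≈⟨ +-congʳ D²≈ ⟩
          (s * s + (s * t + s * t)) + (K + a) + d
            ≈⟨ solve 5 (λ ss st K a d → (ss :+ (st :+ st)) :+ (K :+ a) :+ d
                 := ((ss :+ st) :+ (st :+ (a :+ d))) :+ K) refl (s * s) (s * t) K a d ⟩
          ((s * s + s * t) + (s * t + (a + d))) + K
            ≈⟨ +-congʳ (+-cong (trans (sym sD≈) sD≈X+d) (sym (+-assoc _ a d))) ⟩
          ((X + d) + (X + d)) + K                        ∎
        XX≈ : a * (D * D) + d * K ≈ X * X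
        XX≈ = +-cancelʳ (d * ((X + d) + (X + d))) _ _ (begin
          a * (D * D) + d * K + d * ((X + d) + (X + d))
            ≈⟨ solve 4 (λ z d K e → z :+ d :* K :+ d :* e
                 := z :+ d :* (e :+ K)) refl (a * (D * D)) d K ((X + d) + (X + d)) ⟩
          a * (D * D) + d * (((X + d) + (X + d)) + K)    ≈⟨ +-congˡ (*-congˡ DD≈) ⟨
          a * (D * D) + d * (D * D + d)
            ≈⟨ solve 3 (λ a d y → a :* y :+ d :* (y :+ d)
                 := (a :+ d) :* y :+ d :* d) refl a d (D * D) ⟩
          (a + d) * (D * D) + d * d                      ≈⟨ +-congʳ (*-congʳ ss≈a+d) ⟨
          s * s * (D * D) + d * d
            ≈⟨ +-congʳ (solve 2 (λ s D → s :* s :* (D :* D) := s :* D :* (s :* D)) refl s D) ⟩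
          s * D * (s * D) + d * d                        ≈⟨ +-congʳ (*-cong sD≈X+d sD≈X+d) ⟩
          (X + d) * (X + d) + d * d
            ≈⟨ solve 2 (λ X d → (X :+ d) :* (X :+ d) :+ d :* d
                 := X :* X :+ d :* ((X :+ d) :+ (X :+ d))) refl X d ⟩
          X * X + d * ((X + d) + (X + d))                ∎)
        uu≈ : a + d * K * (D ⁻¹ * D ⁻¹) ≈ u * u
        uu≈ = begin
          a + d * K * (D ⁻¹ * D ⁻¹)                            ≈⟨ +-congʳ (cancelD² a) ⟨
          a * (D * D) * (D ⁻¹ * D ⁻¹) + d * K * (D ⁻¹ * D ⁻¹)  ≈⟨ distribʳ _ _ _ ⟨
          (a * (D * D) + d * K) * (D ⁻¹ * D ⁻¹)                ≈⟨ *-congʳ XX≈ ⟩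
          X * X * (D ⁻¹ * D ⁻¹)
            ≈⟨ solve 2 (λ X i → X :* X :* (i :* i) := (X :* i) :* (X :* i)) refl X (D ⁻¹) ⟩
          u * u                                                ∎
        u-bound : IsUpperBound P u
        u-bound x xx≤a = sq-reflects-≤ 0≤u (≤-trans xx≤a (≤-respʳ-≈ uu≈
          (x≤x+d a (*-nonneg (*-nonneg 0≤d 0≤K) (sq-nonneg (D ⁻¹))))))
        q≤0 : d * D ⁻¹ ≤ 0#
        q≤0 = +-cancelˡ-≤0 u (≤-respˡ-≈ s≈ (s-least u u-bound))

    s*s≈a : s * s ≈ a
    s*s≈a with total (s * s) a
    ... | inj₁ ss≤a = below ss≤a
    ... | inj₂ a≤ss = above a≤ss

  abstract
    realSqrt : ∀ {a} → 0# ≤ a → ∃ λ r → 0# ≤ r × r * r ≈ a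
    realSqrt {a} 0≤a =
      let s , s-bound , s-least = supremum (λ x → x * x ≤ a)
            (0# , ≤-respˡ-≈ (sym (zeroˡ 0#)) 0≤a)
            (a + 1# , λ x xx≤a → sq-reflects-≤ (+-nonneg 0≤a 0≤1) (≤-trans xx≤a
              (≤-respʳ-≈
                (solve 1 (λ a → a :+ (a :* a :+ a :+ con 1)
                                := (a :+ con 1) :* (a :+ con 1)) refl a)
                (x≤x+d a (+-nonneg (+-nonneg (*-nonneg 0≤a 0≤a) 0≤a) 0≤1)))))
          open Supremum 0≤a s s-bound s-least
      in s , 0≤s , s*s≈a

module Complex {ℓ} (ℝ : Reals ℓ) where
  open Reals ℝ
  open RealSqrt ℝ
  open RingProperties ring
    using (-1*x≈-x; -0#≈0#; -‿distribˡ-*; -‿involutive; -‿+-comm)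
  open SemiringSolver commutativeSemiring using (solve; _:+_; _:*_; _:=_; con)

  infix  5 _+i_
  infix  8 -ᶜ_
  infixl 7 _*ᶜ_
  infixl 6 _+ᶜ_
  infix  4 _≈ᶜ_

  record ℂ : Set ℓ where
    constructor _+i_
    field
      re : Carrier
      im : Carrier
  open ℂ public

  record _≈ᶜ_ (z w : ℂ) : Set ℓ where
    constructor mk≈
    field
      re≈ : re z ≈ re w
      im≈ : im z ≈ im w
  open _≈ᶜ_ public

  _+ᶜ_ : Op₂ ℂ
  (a +i b) +ᶜ (c +i d) = a + c +i b + d

  _*ᶜ_ : Op₂ ℂ
  (a +i b) *ᶜ (c +i d) = a * c + - (b * d) +i a * d + b * c

  -ᶜ_ : Op₁ ℂ
  -ᶜ (a +i b) = - a +i - b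

  0ᶜ 1ᶜ : ℂ
  0ᶜ = 0# +i 0#
  1ᶜ = 1# +i 0#

  conj : ℂ → ℂ
  conj (a +i b) = a +i - b

  private
    -x≈-1*x : ∀ x → - x ≈ - 1# * x
    -x≈-1*x x = sym (-1*x≈-x x)

    re* : ∀ a b c d → a * c + - (b * d) ≈ a * c + - 1# * (b * d)
    re* a b c d = +-congˡ (-x≈-1*x (b * d))

    *ᶜ-cong : ∀ {z z′ w w′} → z ≈ᶜ z′ → w ≈ᶜ w′ → z *ᶜ w ≈ᶜ z′ *ᶜ w′
    *ᶜ-cong (mk≈ p q) (mk≈ r s) = mk≈
      (+-cong (*-cong p r) (-‿cong (*-cong q s)))
      (+-cong (*-cong p s) (*-cong q r))

    *ᶜ-assoc : ∀ u z w → (u *ᶜ z) *ᶜ w ≈ᶜ u *ᶜ (z *ᶜ w)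
    *ᶜ-assoc (a +i b) (c +i d) (e +i f) = mk≈
      (begin
        (a * c + - (b * d)) * e + - ((a * d + b * c) * f)
          ≈⟨ re* _ _ e f ⟩
        (a * c + - (b * d)) * e + - 1# * ((a * d + b * c) * f)
          ≈⟨ +-congʳ (*-congʳ (re* a b c d)) ⟩
        (a * c + - 1# * (b * d)) * e + - 1# * ((a * d + b * c) * f)
          ≈⟨ solve 7 (λ n a b c d e f →
               (a :* c :+ n :* (b :* d)) :* e :+ n :* ((a :* d :+ b :* c) :* f)
               := a :* (c :* e :+ n :* (d :* f)) :+ n :* (b :* (c :* f :+ d :* e)))
               refl (- 1#) a b c d e f ⟩
        a * (c * e + - 1# * (d * f)) + - 1# * (b * (c * f + d * e))
          ≈⟨ +-congʳ (*-congˡ (re* c d e f)) ⟨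
        a * (c * e + - (d * f)) + - 1# * (b * (c * f + d * e))
          ≈⟨ re* a b _ _ ⟨
        a * (c * e + - (d * f)) + - (b * (c * f + d * e))  ∎)
      (begin
        (a * c + - (b * d)) * f + (a * d + b * c) * e
          ≈⟨ +-congʳ (*-congʳ (re* a b c d)) ⟩
        (a * c + - 1# * (b * d)) * f + (a * d + b * c) * e
          ≈⟨ solve 7 (λ n a b c d e f →
               (a :* c :+ n :* (b :* d)) :* f :+ (a :* d :+ b :* c) :* e
               := a :* (c :* f :+ d :* e) :+ b :* (c :* e :+ n :* (d :* f)))
               refl (- 1#) a b c d e f ⟩
        a * (c * f + d * e) + b * (c * e + - 1# * (d * f))
          ≈⟨ +-congˡ (*-congˡ (re* c d e f)) ⟨
        a * (c * f + d * e) + b * (c * e + - (d * f))  ∎)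
      where open SetoidReasoning setoid

    *ᶜ-comm : ∀ z w → z *ᶜ w ≈ᶜ w *ᶜ z
    *ᶜ-comm (a +i b) (c +i d) = mk≈
      (+-cong (*-comm a c) (-‿cong (*-comm b d)))
      (trans (+-comm _ _) (+-cong (*-comm b c) (*-comm a d)))

    *ᶜ-identityˡ : ∀ z → 1ᶜ *ᶜ z ≈ᶜ z
    *ᶜ-identityˡ (a +i b) = mk≈
      (trans (+-cong (*-identityˡ a) (trans (-‿cong (zeroˡ b)) -0#≈0#)) (+-identityʳ a))
      (trans (+-cong (*-identityˡ b) (zeroˡ a)) (+-identityʳ b))

    *ᶜ-distribˡ : ∀ u z w → u *ᶜ (z +ᶜ w) ≈ᶜ u *ᶜ z +ᶜ u *ᶜ w
    *ᶜ-distribˡ (a +i b) (c +i d) (e +i f) = mk≈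
      (begin
        a * (c + e) + - (b * (d + f))                           ≈⟨ re* a b _ _ ⟩
        a * (c + e) + - 1# * (b * (d + f))
          ≈⟨ solve 7 (λ n a b c d e f →
               a :* (c :+ e) :+ n :* (b :* (d :+ f))
               := (a :* c :+ n :* (b :* d)) :+ (a :* e :+ n :* (b :* f)))
               refl (- 1#) a b c d e f ⟩
        (a * c + - 1# * (b * d)) + (a * e + - 1# * (b * f))
          ≈⟨ +-cong (re* a b c d) (re* a b e f) ⟨
        (a * c + - (b * d)) + (a * e + - (b * f))               ∎)
      (solve 6 (λ a b c d e f → a :* (d :+ f) :+ b :* (c :+ e)
         := (a :* d :+ b :* c) :+ (a :* f :+ b :* e)) refl a b c d e f)
      where open SetoidReasoning setoid

    ≈ᶜ-trans : ∀ {x y z} → x ≈ᶜ y → y ≈ᶜ z → x ≈ᶜ z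
    ≈ᶜ-trans (mk≈ p q) (mk≈ r s) = mk≈ (trans p r) (trans q s)

  ℂ-commutativeRing : CommutativeRing ℓ ℓ
  ℂ-commutativeRing = record
    { Carrier = ℂ
    ; _≈_ = _≈ᶜ_
    ; _+_ = _+ᶜ_
    ; _*_ = _*ᶜ_
    ; -_ = -ᶜ_
    ; 0# = 0ᶜ
    ; 1# = 1ᶜ
    ; isCommutativeRing = record
      { isRing = record
        { +-isAbelianGroup = record
          { isGroup = record
            { isMonoid = record
              { isSemigroup = record
                { isMagma = record
                  { isEquivalence = record
                    { refl = mk≈ refl refl
                    ; sym = λ (mk≈ p q) → mk≈ (sym p) (sym q)
                    ; trans = ≈ᶜ-trans
                    }
                  ; ∙-cong = λ (mk≈ p q) (mk≈ r s) → mk≈ (+-cong p r) (+-cong q s)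
                  }
                ; assoc = λ u z w → mk≈ (+-assoc _ _ _) (+-assoc _ _ _)
                }
              ; identity = (λ z → mk≈ (+-identityˡ _) (+-identityˡ _))
                         , (λ z → mk≈ (+-identityʳ _) (+-identityʳ _))
              }
            ; inverse = (λ z → mk≈ (-‿inverseˡ _) (-‿inverseˡ _))
                      , (λ z → mk≈ (-‿inverseʳ _) (-‿inverseʳ _))
            ; ⁻¹-cong = λ (mk≈ p q) → mk≈ (-‿cong p) (-‿cong q)
            }
          ; comm = λ z w → mk≈ (+-comm _ _) (+-comm _ _)
          }
        ; *-cong = *ᶜ-cong
        ; *-assoc = *ᶜ-assoc
        ; *-identity = *ᶜ-identityˡ
                     , (λ z → ≈ᶜ-trans (*ᶜ-comm z 1ᶜ) (*ᶜ-identityˡ z))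
        ; distrib = *ᶜ-distribˡ
                  , (λ u z w → ≈ᶜ-trans (*ᶜ-comm (z +ᶜ w) u)
                      (≈ᶜ-trans (*ᶜ-distribˡ u z w)
                        (mk≈ (+-cong (re≈ (*ᶜ-comm u z)) (re≈ (*ᶜ-comm u w)))
                             (+-cong (im≈ (*ᶜ-comm u z)) (im≈ (*ᶜ-comm u w))))))
        }
      ; *-comm = *ᶜ-comm
      }
    }

  ℝ⁺ : Pred ℂ ℓ
  ℝ⁺ z = 0# < re z × im z ≈ 0#

  ℝ⁻ : Pred ℂ ℓ
  ℝ⁻ z = re z < 0# × im z ≈ 0#

  -- The square root with argument in (-π/2, π/2].
  IsPrincipalSqrt : ℂ → ℂ → Set ℓ
  IsPrincipalSqrt z w =
    w *ᶜ w ≈ᶜ z × (0# < re w ⊎ (re w ≈ 0# × 0# ≤ im w))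

  -- √(x + iy) = p + iy/(2p) where r = |x + iy| and 2p² = r + x; if p = 0
  -- then y = 0, x ≤ 0 and √x = i√(-x).
  module PrincipalSqrt
    (x y : Carrier) {r p : Carrier}
    (0≤r : 0# ≤ r) (rr≈ : r * r ≈ x * x + y * y)
    (0≤p : 0# ≤ p) (pp+pp≈e : p * p + p * p ≈ r + x)
    where
    open SetoidReasoning setoid

    private
      e : Carrier
      e = r + x

      ee≈ : e * e ≈ x * (e + e) + y * y
      ee≈ = begin
        (r + x) * (r + x)
          ≈⟨ solve 2 (λ r x → (r :+ x) :* (r :+ x)
               := r :* r :+ (x :* r :+ x :* r :+ x :* x)) refl r x ⟩
        r * r + (x * r + x * r + x * x)          ≈⟨ +-congʳ rr≈ ⟩
        x * x + y * y + (x * r + x * r + x * x)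
          ≈⟨ solve 3 (λ r x y → x :* x :+ y :* y :+ (x :* r :+ x :* r :+ x :* x)
               := x :* ((r :+ x) :+ (r :+ x)) :+ y :* y) refl r x y ⟩
        x * (e + e) + y * y                      ∎

    module Positive (p≉0 : ¬ p ≈ 0#) where
      g j q : Carrier
      g = p + p
      j = g ⁻¹
      q = y * j

      g≉0 : ¬ g ≈ 0#
      g≉0 g≈0 = p≉0 (antisym (≤-respʳ-≈ g≈0 (x≤x+d p 0≤p)) 0≤p)

      gj≈1 : g * j ≈ 1#
      gj≈1 = *-inverseʳ g g≉0

      unit : ∀ u → u * (g * j) * (g * j) ≈ u
      unit u = trans (*-cong (trans (*-congˡ gj≈1) (*-identityʳ u)) gj≈1) (*-identityʳ u)

      gg≈ : g * g ≈ e + e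
      gg≈ = trans
        (solve 1 (λ p → (p :+ p) :* (p :+ p)
           := (p :* p :+ p :* p) :+ (p :* p :+ p :* p)) refl p)
        (+-cong pp+pp≈e pp+pp≈e)

      pp≈x+qq : p * p ≈ x + q * q
      pp≈x+qq = begin
        p * p                                  ≈⟨ unit (p * p) ⟨
        p * p * (g * j) * (g * j)
          ≈⟨ solve 2 (λ p j → p :* p :* ((p :+ p) :* j) :* ((p :+ p) :* j)
               := (p :* p :+ p :* p) :* (p :* p :+ p :* p) :* (j :* j)) refl p j ⟩
        (p * p + p * p) * (p * p + p * p) * (j * j)
          ≈⟨ *-congʳ (*-cong pp+pp≈e pp+pp≈e) ⟩
        e * e * (j * j)                        ≈⟨ *-congʳ ee≈ ⟩
        (x * (e + e) + y * y) * (j * j)        ≈⟨ *-congʳ (+-congʳ (*-congˡ gg≈)) ⟨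
        (x * (g * g) + y * y) * (j * j)
          ≈⟨ solve 4 (λ x y g j → (x :* (g :* g) :+ y :* y) :* (j :* j)
               := x :* (g :* j) :* (g :* j) :+ (y :* j) :* (y :* j)) refl x y g j ⟩
        x * (g * j) * (g * j) + q * q          ≈⟨ +-congʳ (unit x) ⟩
        x + q * q                              ∎

      pp-qq≈x : p * p + - (q * q) ≈ x
      pp-qq≈x = begin
        p * p + - (q * q)          ≈⟨ +-congʳ pp≈x+qq ⟩
        (x + q * q) + - (q * q)    ≈⟨ +-assoc x _ _ ⟩
        x + (q * q + - (q * q))    ≈⟨ +-congˡ (-‿inverseʳ _) ⟩
        x + 0#                     ≈⟨ +-identityʳ x ⟩
        x                          ∎

      pq+qp≈y : p * q + q * p ≈ y
      pq+qp≈y = begin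
        p * (y * j) + y * j * p
          ≈⟨ solve 3 (λ p y j → p :* (y :* j) :+ y :* j :* p := y :* ((p :+ p) :* j)) refl p y j ⟩
        y * (g * j)                ≈⟨ *-congˡ gj≈1 ⟩
        y * 1#                     ≈⟨ *-identityʳ y ⟩
        y                          ∎

      isPrincipal : IsPrincipalSqrt (x +i y) (p +i q)
      isPrincipal = mk≈ pp-qq≈x pq+qp≈y , inj₁ (0≤p , λ 0≈p → p≉0 (sym 0≈p))

    module Zero (p≈0 : p ≈ 0#) where
      e≈0 : e ≈ 0#
      e≈0 = begin
        e                ≈⟨ pp+pp≈e ⟨
        p * p + p * p    ≈⟨ +-cong (*-congʳ p≈0) (*-congʳ p≈0) ⟩
        0# * p + 0# * p  ≈⟨ +-cong (zeroˡ p) (zeroˡ p) ⟩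
        0# + 0#          ≈⟨ +-identityˡ 0# ⟩
        0#               ∎

      y≈0 : y ≈ 0#
      y≈0 = x*x≈0⇒x≈0 (begin
        y * y                  ≈⟨ +-identityˡ _ ⟨
        0# + y * y             ≈⟨ +-congʳ (zeroʳ x) ⟨
        x * 0# + y * y         ≈⟨ +-congʳ (*-congˡ (trans (+-cong e≈0 e≈0) (+-identityˡ 0#))) ⟨
        x * (e + e) + y * y    ≈⟨ ee≈ ⟨
        e * e                  ≈⟨ *-congʳ e≈0 ⟩
        0# * e                 ≈⟨ zeroˡ e ⟩
        0#                     ∎)

      q-sqrt : ∃ λ q → 0# ≤ q × q * q ≈ - x
      q-sqrt = realSqrt (≤0⇒0≤- (≤-respʳ-≈ e≈0 (≤-respʳ-≈ (+-comm x r) (x≤x+d x 0≤r))))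
      q = proj₁ q-sqrt

      -qq≈x : 0# * 0# + - (q * q) ≈ x
      -qq≈x = begin
        0# * 0# + - (q * q)    ≈⟨ +-cong (zeroˡ 0#) (-‿cong (proj₂ (proj₂ q-sqrt))) ⟩
        0# + - - x             ≈⟨ +-identityˡ _ ⟩
        - - x                  ≈⟨ -‿involutive x ⟩
        x                      ∎

      0q+q0≈y : 0# * q + q * 0# ≈ y
      0q+q0≈y = begin
        0# * q + q * 0#  ≈⟨ +-cong (zeroˡ q) (zeroʳ q) ⟩
        0# + 0#          ≈⟨ +-identityˡ 0# ⟩
        0#               ≈⟨ y≈0 ⟨
        y                ∎

      isPrincipal : IsPrincipalSqrt (x +i y) (0# +i q)
      isPrincipal = mk≈ -qq≈x 0q+q0≈y , inj₂ (refl , proj₁ (proj₂ q-sqrt))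

    exists : ∃ (IsPrincipalSqrt (x +i y))
    exists with p ≈? 0#
    ... | no  p≉0 = _ , Positive.isPrincipal p≉0
    ... | yes p≈0 = _ , Zero.isPrincipal p≈0

  0≤r+x : ∀ {r} x y → 0# ≤ r → r * r ≈ x * x + y * y → 0# ≤ r + x
  0≤r+x x y 0≤r rr≈ = ≤-respˡ-≈ (-‿inverseˡ x) (+-monoˡ-≤ x (sq-reflects-≤ 0≤r
    (≤-respˡ-≈ (sym (-x*-x≈x*x x)) (≤-respʳ-≈ (sym rr≈)
      (x≤x+d (x * x) (sq-nonneg y))))))

  halve : ∀ {u e} → u ≈ e * (1# + 1#) ⁻¹ → u + u ≈ e
  halve {u} {e} u≈ = begin
    u + u                            ≈⟨ +-cong u≈ u≈ ⟩
    e * half + e * half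
      ≈⟨ solve 2 (λ e h → e :* h :+ e :* h := e :* ((con 1 :+ con 1) :* h)) refl e half ⟩
    e * ((1# + 1#) * half)           ≈⟨ *-congˡ (*-inverseʳ _ (1+x≉0 0≤1)) ⟩
    e * 1#                           ≈⟨ *-identityʳ e ⟩
    e                                ∎
    where
    open SetoidReasoning setoid
    half : Carrier
    half = (1# + 1#) ⁻¹

  abstract
    principalSqrt : ∀ z → ∃ (IsPrincipalSqrt z)
    principalSqrt (x +i y) =
      let r , 0≤r , rr≈ = realSqrt (+-nonneg (sq-nonneg x) (sq-nonneg y))
          p , 0≤p , pp≈ = realSqrt (*-nonneg (0≤r+x x y 0≤r rr≈)
            (⁻¹-nonneg (+-nonneg 0≤1 0≤1) (1+x≉0 0≤1)))
      in PrincipalSqrt.exists x y 0≤r rr≈ 0≤p (halve pp≈)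

  √_ : ℂ → ℂ
  √ z = proj₁ (principalSqrt z)

module LinearAlgebra {c ℓ} (R : CommutativeRing c ℓ) where
  open CommutativeRing R
  open RawMonoidDefinitions +-rawMonoid using (sum)

  -- M i j is the entry in row i and column j.
  Matrix : ℕ → ℕ → Set c
  Matrix n m = Vector (Vector Carrier m) n

  linearCombination : ∀ {n r} → Vector Carrier r → Vector (Vector Carrier n) r →
                      Vector Carrier n
  linearCombination x v i = sum λ k → x k * v k i

  LinearlyIndependent : ∀ {n r} → Vector (Vector Carrier n) r → Set _
  LinearlyIndependent v =
    ∀ x → (∀ i → linearCombination x v i ≈ 0#) → ∀ k → x k ≈ 0#

  _∈Span_ : ∀ {n r} → Vector Carrier n → Vector (Vector Carrier n) r → Set _
  u ∈Span v = ∃ λ x → ∀ i → u i ≈ linearCombination x v i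

  -- HasRank M r: the column space of M has a basis of r vectors, i.e. it has
  -- dimension r (over a field, r is determined by M).
  HasRank : ∀ {n m} → Matrix n m → ℕ → Set _
  HasRank {n} M r = ∃ λ (b : Vector (Vector Carrier n) r) →
    LinearlyIndependent b
    × (∀ k → b k ∈Span transpose M)
    × (∀ j → transpose M j ∈Span b)

-- V(G) = Fin n and E(G) = {e₁,…,eₘ}, indexed by Fin m.  The three conditions
-- make the underlying graph simple, each of its edges carrying one direction.
record OrientedGraph (n m : ℕ) : Set where
  field
    source target : Fin m → Fin n
    loopless : ∀ e → source e ≢ target e
    distinct : ∀ e f → source e ≡ source f → target e ≡ target f → e ≡ f
    oriented : ∀ e f → source e ≡ target f → target e ≢ source f

  infix 4 _⟶_ _~_

  _⟶_ : Rel (Fin n) _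
  u ⟶ v = ∃ λ e → source e ≡ u × target e ≡ v

  _⟶?_ : ∀ u v → Dec (u ⟶ v)
  u ⟶? v = any? λ e → (source e ≟ u) ×-dec (target e ≟ v)

  -- Adjacency in the underlying graph.
  _~_ : Rel (Fin n) _
  u ~ v = u ⟶ v ⊎ v ⟶ u

  WeaklyConnected : Set
  WeaklyConnected = ∀ u v → Star _~_ u v

  -- The cycle visits base, then the vertices of rest in order, then base again.
  record Cycle : Set where
    field
      base   : Fin n
      rest   : List (Fin n)
      length≥3 : 3 ℕ.≤ List.length (base ∷ rest)
      unique : Unique (base ∷ rest)
      closed : Linked _~_ (base ∷ rest ∷ʳ base)

    length : ℕ
    length = List.length (base ∷ rest)

    closedWalk : List (Fin n)
    closedWalk = base ∷ rest ∷ʳ base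

  Even Odd : Cycle → Set
  Even C = 2 ∣ Cycle.length C
  Odd C = ¬ Even C

  IsTree : Set
  IsTree = WeaklyConnected × ¬ Cycle

module Weighted {ℓ} (ℝ : Reals ℓ) where
  open Complex ℝ

  record WeightedOrientedGraph (n m : ℕ) : Set ℓ where
    field
      orientedGraph : OrientedGraph n m
    open OrientedGraph orientedGraph public

    field
      -- weight e is w_uv for the edge e = (u,v).
      weight   : Fin m → ℂ
      weight≉0 : ∀ e → ¬ weight e ≈ᶜ 0ᶜ

    open LinearAlgebra ℂ-commutativeRing using (Matrix)

    N : Matrix n m
    N i j with i ≟ source j | i ≟ target j
    ... | yes _ | _     = √ weight j
    ... | no _  | yes _ = √ conj (weight j)
    ... | no _  | no _  = 0ᶜ

    a : Fin n → Fin n → ℂ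
    a i j with i ⟶? j | j ⟶? i
    ... | yes (e , _) | _           = weight e
    ... | no _        | yes (e , _) = conj (weight e)
    ... | no _        | no _        = 0ᶜ

    -- wt (i₁ ∷ … ∷ iₖ ∷ []) is the weight of the walk (i₁,…,iₖ).
    wt : List (Fin n) → ℂ
    wt []          = 1ᶜ
    wt (_ ∷ [])    = 1ᶜ
    wt (i ∷ j ∷ γ) = a i j *ᶜ wt (j ∷ γ)

    wtCycle : Cycle → ℂ
    wtCycle C = wt (Cycle.closedWalk C)

module Submission where

-- A left null vector x of N satisfies x_v = σ(u,v) x_u along each edge, with
-- the unimodular gains σ(u,v) = -a_uv/|a_uv|.  Since G is connected, the left
-- kernel has dimension at most 1, and it is nonzero exactly when every closed
-- walk has gain 1.  Loop erasure reduces this to cycles, where it is the sign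
-- condition, because wt(γ) = (-1)^k T gain(γ) with T > 0 for a walk γ with k edges.

open import Defs
open import Algebra.Bundles using (CommutativeRing)
open import Data.Fin.Base using (Fin; zero; suc; punchIn; punchOut)
open import Data.Fin.Properties using (_≟_; any?; punchIn-punchOut)
open import Data.List.Base as List using (List; []; _∷_; _∷ʳ_; _++_; foldl)
open import Data.List.Membership.DecPropositional using (_∈?_)
open import Data.List.Membership.Propositional using (_∈_; _∉_)
open import Data.List.Membership.Propositional.Properties using (∈-∃++)
open import Data.List.Properties using (foldl-++; foldl-∷ʳ; length-++; ∷-injective)
open import Data.List.Relation.Unary.All using ([]; _∷_)
open import Data.List.Relation.Unary.All.Properties using (++⁻; ¬Any⇒All¬; All¬⇒¬Any)
open import Data.List.Relation.Unary.AllPairs using ([]; _∷_)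
open import Data.List.Relation.Unary.Any using (here; there)
open import Data.List.Relation.Unary.Linked using (Linked; [-]; _∷_)
open import Data.List.Relation.Unary.Unique.Propositional using (Unique)
open import Data.Nat.Base using (ℕ; zero; suc; s≤s; z≤n)
open import Data.Nat.Divisibility using (_∣_; _∣0; ∣-refl; ∣1⇒≡1; ∣m∣n⇒∣m+n; ∣m+n∣m⇒∣n)
open import Data.Product using (∃; _×_; _,_; proj₁; proj₂)
open import Data.Sum using (_⊎_; inj₁; inj₂; [_,_]′)
open import Data.Vec.Functional using (Vector; transpose)
open import Function.Base using (_∘_; id)
open import Function.Bundles using (_⇔_; mk⇔)
open import Level using (_⊔_)
open import Relation.Binary.Construct.Closure.ReflexiveTransitive using (Star; ε; _◅_; _◅◅_)
open import Relation.Binary.PropositionalEquality as ≡ using (_≡_; _≢_)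
open import Relation.Nullary using (¬_; Dec; yes; no; contradiction)
open import Relation.Nullary.Decidable using (¬?; decidable-stable; map′; _×-dec_)

import Algebra.Properties.Ring as RingProperties
import Algebra.Properties.Semiring.Sum as SemiringSum
import Algebra.Solver.Ring.NaturalCoefficients.Default as SemiringSolver
import Data.Nat.Properties as ℕ
import Relation.Binary.Reasoning.Setoid as SetoidReasoning

-- The rank is tied to the left kernel without a dimension formula. A spanning set of n - 1 vectors
-- for the column space imposes n - 1 linear conditions on n unknowns, so elimination yields a
-- nonzero `x` that annihilates every column; conversely, a nowhere-zero potential gives an explicit
-- basis of n - 1 vectors. The branch cut explains the restriction on the weights. Off the negative
-- reals √(conj w) is the conjugate of √w, so the two roots multiply to |w|. Multiplying the null
-- equation x_u √w + x_v √(conj w) = 0 by √w gives w x_u + |w| x_v = 0, which is the origin of the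
-- gain -w/|w|. For a negative w the product would be -|w| and the gain would change sign.

-- Ring identities, with negation written as a factor `- 1#` that the semiring solver treats as a
-- variable.

module RingArithmetic {c ℓ} (R : CommutativeRing c ℓ) where
  open CommutativeRing R hiding (zero)
  open RingProperties ring using (-1*x≈-x; -‿involutive)
  open SemiringSolver commutativeSemiring using (solve; _:+_; _:*_; _:=_)
  open SetoidReasoning setoid

  1+-1*x≈0 : ∀ x → x + - 1# * x ≈ 0#
  1+-1*x≈0 x = trans (+-congˡ (-1*x≈-x x)) (-‿inverseʳ x)

  -1*-1≈1 : - 1# * - 1# ≈ 1#
  -1*-1≈1 = trans (-1*x≈-x (- 1#)) (-‿involutive 1#)

  x+y≈0⇒y≈-1*x : ∀ {x y} → x + y ≈ 0# → y ≈ - 1# * x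
  x+y≈0⇒y≈-1*x {x} {y} x+y≈0 = begin
    y                     ≈⟨ +-identityʳ y ⟨
    y + 0#                ≈⟨ +-congˡ (1+-1*x≈0 x) ⟨
    y + (x + - 1# * x)
      ≈⟨ solve 3 (λ x y z → y :+ (x :+ z) := (x :+ y) :+ z) refl x y (- 1# * x) ⟩
    (x + y) + - 1# * x    ≈⟨ +-congʳ x+y≈0 ⟩
    0# + - 1# * x         ≈⟨ +-identityˡ _ ⟩
    - 1# * x              ∎

  *-cancelˡ-unit : ∀ {u} u′ {x y} → u * u′ ≈ 1# → u * x ≈ u * y → x ≈ y
  *-cancelˡ-unit {u} u′ {x} {y} uu′≈1 ux≈uy = begin
    x             ≈⟨ unit x ⟨
    u′ * (u * x)  ≈⟨ *-congˡ ux≈uy ⟩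
    u′ * (u * y)  ≈⟨ unit y ⟩
    y             ∎
    where
    unit : ∀ z → u′ * (u * z) ≈ z
    unit z = begin
      u′ * (u * z)  ≈⟨ solve 3 (λ u u′ z → u′ :* (u :* z) := (u :* u′) :* z) refl u u′ z ⟩
      u * u′ * z    ≈⟨ *-congʳ uu′≈1 ⟩
      1# * z        ≈⟨ *-identityˡ z ⟩
      z             ∎

-- Finite sums, unit vectors and spans.

module SpanProperties {c ℓ} (R : CommutativeRing c ℓ) where
  open CommutativeRing R hiding (zero)
  open LinearAlgebra R
  open RingArithmetic R
  open SemiringSum semiring
  open SemiringSolver commutativeSemiring using (solve; _:+_; _:*_; _:=_)
  open SetoidReasoning setoid

  sum-zero : ∀ {n} {f : Vector Carrier n} → (∀ i → f i ≈ 0#) → sum f ≈ 0#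
  sum-zero {n} f≈0 = trans (sum-cong-≋ f≈0) (sum-replicate-zero n)

  -- Recursion on the indices, rather than a decision of equality, makes the entries compute:
  -- `b-diagonal` relies on `δ zero (suc j)` reducing to `0#`.
  δ : ∀ {n} → Fin n → Vector Carrier n
  δ zero    zero    = 1#
  δ zero    (suc _) = 0#
  δ (suc _) zero    = 0#
  δ (suc i) (suc j) = δ i j

  δ-refl : ∀ {n} (i : Fin n) → δ i i ≡ 1#
  δ-refl zero    = ≡.refl
  δ-refl (suc i) = δ-refl i

  δ-≢ : ∀ {n} {i j : Fin n} → i ≢ j → δ i j ≡ 0#
  δ-≢ {i = zero}  {zero}  i≢j = contradiction ≡.refl i≢j
  δ-≢ {i = zero}  {suc _} i≢j = ≡.refl
  δ-≢ {i = suc _} {zero}  i≢j = ≡.refl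
  δ-≢ {i = suc _} {suc _} i≢j = δ-≢ (i≢j ∘ ≡.cong suc)

  δ-sym : ∀ {n} (i j : Fin n) → δ i j ≡ δ j i
  δ-sym zero    zero    = ≡.refl
  δ-sym zero    (suc _) = ≡.refl
  δ-sym (suc _) zero    = ≡.refl
  δ-sym (suc i) (suc j) = δ-sym i j

  sum-*δ : ∀ {n} (f : Vector Carrier n) i → sum (λ j → f j * δ i j) ≈ f i
  sum-*δ f zero = trans
    (+-cong (*-identityʳ _) (sum-zero (λ j → zeroʳ (f (suc j))))) (+-identityʳ _)
  sum-*δ f (suc i) = trans
    (+-cong (zeroʳ _) (sum-*δ (f ∘ suc) i)) (+-identityˡ _)

  sum-*-linear : ∀ {n} (x f g : Vector Carrier n) a →
    sum (λ i → x i * (f i + a * g i)) ≈ sum (λ i → x i * f i) + a * sum (λ i → x i * g i)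
  sum-*-linear x f g a = begin
    sum (λ i → x i * (f i + a * g i))
      ≈⟨ sum-cong-≋ (λ i → solve 4 (λ x f g a →
           x :* (f :+ a :* g) := x :* f :+ a :* (x :* g)) refl (x i) (f i) (g i) a) ⟩
    sum (λ i → x i * f i + a * (x i * g i))
      ≈⟨ ∑-distrib-+ (λ i → x i * f i) (λ i → a * (x i * g i)) ⟩
    sum (λ i → x i * f i) + sum (λ i → a * (x i * g i))
      ≈⟨ +-congˡ (*-distribˡ-sum a (λ i → x i * g i)) ⟨
    sum (λ i → x i * f i) + a * sum (λ i → x i * g i)  ∎

  module _ {n r} {v : Vector (Vector Carrier n) r} where

    span-cong : ∀ {u w} → (∀ i → u i ≈ w i) → u ∈Span v → w ∈Span v
    span-cong u≈w (x , u≈) = x , λ i → trans (sym (u≈w i)) (u≈ i)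

    span-zero : (λ _ → 0#) ∈Span v
    span-zero = (λ _ → 0#) , λ i → sym (sum-zero (λ k → zeroˡ (v k i)))

    span-generator : ∀ k → v k ∈Span v
    span-generator k = δ k , λ i → sym (trans
      (sum-cong-≋ (λ j → *-comm (δ k j) (v j i))) (sum-*δ (λ j → v j i) k))

    span-+ : ∀ {u w} → u ∈Span v → w ∈Span v → (λ i → u i + w i) ∈Span v
    span-+ {u} {w} (x , u≈) (y , w≈) = (λ k → x k + y k) , λ i → begin
      u i + w i                                        ≈⟨ +-cong (u≈ i) (w≈ i) ⟩
      sum (λ k → x k * v k i) + sum (λ k → y k * v k i)
        ≈⟨ ∑-distrib-+ (λ k → x k * v k i) (λ k → y k * v k i) ⟨
      sum (λ k → x k * v k i + y k * v k i)
        ≈⟨ sum-cong-≋ (λ k → sym (distribʳ (v k i) (x k) (y k))) ⟩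
      sum (λ k → (x k + y k) * v k i)                  ∎

    span-* : ∀ {u} a → u ∈Span v → (λ i → a * u i) ∈Span v
    span-* {u} a (x , u≈) = (λ k → a * x k) , λ i → begin
      a * u i                        ≈⟨ *-congˡ (u≈ i) ⟩
      a * sum (λ k → x k * v k i)    ≈⟨ *-distribˡ-sum a (λ k → x k * v k i) ⟩
      sum (λ k → a * (x k * v k i))
        ≈⟨ sum-cong-≋ (λ k → sym (*-assoc a (x k) (v k i))) ⟩
      sum (λ k → a * x k * v k i)    ∎

    -- Expanding `u` in the generators and interchanging the two sums leaves a combination of the
    -- vanishing products with `v k`.
    span-annihilated : ∀ {u} (x : Vector Carrier n) → (∀ k → sum (λ i → x i * v k i) ≈ 0#) →
      u ∈Span v → sum (λ i → x i * u i) ≈ 0#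
    span-annihilated {u} x xv≈0 (y , u≈) = begin
      sum (λ i → x i * u i)
        ≈⟨ sum-cong-≋ (λ i → *-congˡ (u≈ i)) ⟩
      sum (λ i → x i * sum (λ k → y k * v k i))
        ≈⟨ sum-cong-≋ (λ i → *-distribˡ-sum (x i) (λ k → y k * v k i)) ⟩
      sum (λ i → sum (λ k → x i * (y k * v k i)))
        ≈⟨ ∑-comm (λ i k → x i * (y k * v k i)) ⟩
      sum (λ k → sum (λ i → x i * (y k * v k i)))
        ≈⟨ sum-cong-≋ (λ k → sum-cong-≋ (λ i → solve 3 (λ x y v →
             x :* (y :* v) := y :* (x :* v)) refl (x i) (y k) (v k i))) ⟩
      sum (λ k → sum (λ i → y k * (x i * v k i)))
        ≈⟨ sum-cong-≋ (λ k → sym (*-distribˡ-sum (y k) (λ i → x i * v k i))) ⟩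
      sum (λ k → y k * sum (λ i → x i * v k i))
        ≈⟨ sum-zero (λ k → trans (*-congˡ (xv≈0 k)) (zeroʳ (y k))) ⟩
      0#  ∎

-- Homogeneous systems with more unknowns than equations.

module FieldLinearAlgebra {c ℓ} (R : CommutativeRing c ℓ) where
  open CommutativeRing R hiding (zero)
  open LinearAlgebra R
  open RingArithmetic R
  open SpanProperties R
  open SemiringSum semiring using (sum)
  open SemiringSolver commutativeSemiring using (solve; _:+_; _:*_; _:=_)
  open SetoidReasoning setoid

  module _
    (1≉0 : ¬ 1# ≈ 0#)
    (_≟0 : ∀ x → Dec (x ≈ 0#))
    (inverse : ∀ {x} → ¬ x ≈ 0# → ∃ λ y → x * y ≈ 1#)
    where

    -- Gaussian elimination by induction on the number of equations. If the first unknown occurs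
    -- nowhere, the first unit vector is a solution; otherwise a pivot row `p` eliminates that
    -- unknown from the other rows, and the remaining system again has one unknown more than
    -- equations.
    underdetermined : ∀ r (A : Vector (Vector Carrier (suc r)) r) →
      ∃ λ (x : Vector Carrier (suc r)) →
        (∃ λ i → ¬ x i ≈ 0#) × (∀ k → sum (λ i → x i * A k i) ≈ 0#)
    underdetermined zero    A = (λ _ → 1#) , (zero , 1≉0) , λ ()
    underdetermined (suc r) A with any? (λ k → ¬? (A k zero ≟0))
    ... | no all≈0 = δ zero , (zero , 1≉0) , λ k → begin
      1# * A k zero + sum (λ i → 0# * A k (suc i))
        ≈⟨ +-cong (*-identityˡ _) (sum-zero (λ i → zeroˡ (A k (suc i)))) ⟩
      A k zero + 0#  ≈⟨ +-identityʳ _ ⟩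
      A k zero       ≈⟨ decidable-stable (A k zero ≟0) (λ Ak≉0 → all≈0 (k , Ak≉0)) ⟩
      0#             ∎
    ... | yes (p , Ap≉0) with inverse Ap≉0
    ...   | q , Apq≈1 = x , (let i , x′i≉0 = x′≉0 in suc i , x′i≉0) , solves
      where
      ratio : Fin (suc r) → Carrier
      ratio k = A k zero * q
      reduced : Vector (Vector Carrier (suc r)) r
      reduced k i = A (punchIn p k) (suc i) + - 1# * ratio (punchIn p k) * A p (suc i)
      IH = underdetermined r reduced
      x′ = proj₁ IH
      x′≉0 = proj₁ (proj₂ IH)
      s : Fin (suc r) → Carrier
      s k = sum (λ i → x′ i * A k (suc i))
      x : Vector Carrier (suc (suc r))
      -- Back-substitution: the value that row `p` forces, since `q` inverts the pivot.
      x zero    = - 1# * (q * s p)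
      x (suc i) = x′ i
      -- The reduced equations say exactly this for the rows other than `p`, and `ratio p` is 1.
      -- Hence the value chosen for row `p` solves every row.
      s≈ : ∀ k → s k ≈ ratio k * s p
      s≈ k with p ≟ k
      ... | yes ≡.refl = sym (trans (*-congʳ Apq≈1) (*-identityˡ (s p)))
      ... | no  p≢k = ≡.subst (λ k → s k ≈ ratio k * s p) (punchIn-punchOut p≢k) (begin
        s k′                                      ≈⟨ +-identityʳ _ ⟨
        s k′ + 0#                                 ≈⟨ +-congˡ (1+-1*x≈0 (ratio k′ * s p)) ⟨
        s k′ + (ratio k′ * s p + - 1# * (ratio k′ * s p))
          ≈⟨ solve 4 (λ s c t n → s :+ (c :* t :+ n :* (c :* t))
               := (s :+ n :* c :* t) :+ c :* t) refl (s k′) (ratio k′) (s p) (- 1#) ⟩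
        (s k′ + - 1# * ratio k′ * s p) + ratio k′ * s p
          ≈⟨ +-congʳ (sum-*-linear x′ (A k′ ∘ suc) (A p ∘ suc) (- 1# * ratio k′)) ⟨
        sum (λ i → x′ i * reduced (punchOut p≢k) i) + ratio k′ * s p
          ≈⟨ +-congʳ (proj₂ (proj₂ IH) (punchOut p≢k)) ⟩
        0# + ratio k′ * s p                       ≈⟨ +-identityˡ _ ⟩
        ratio k′ * s p                            ∎)
        where k′ = punchIn p (punchOut p≢k)
      solves : ∀ k → x zero * A k zero + s k ≈ 0#
      solves k = begin
        - 1# * (q * s p) * A k zero + s k           ≈⟨ +-congˡ (s≈ k) ⟩
        - 1# * (q * s p) * A k zero + A k zero * q * s p
          ≈⟨ solve 4 (λ n q t a → n :* (q :* t) :* a :+ a :* q :* t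
               := a :* q :* t :+ n :* (a :* q :* t)) refl (- 1#) q (s p) (A k zero) ⟩
        ratio k * s p + - 1# * (ratio k * s p)      ≈⟨ 1+-1*x≈0 _ ⟩
        0#                                          ∎

    -- The basis vectors serve as the rows of the system; a vector annihilating them annihilates
    -- their span, which contains the columns.
    rank<rows⇒leftKernel : ∀ {r m} {M : Matrix (suc r) m} → HasRank M r →
      ∃ λ (x : Vector Carrier (suc r)) →
        (∃ λ i → ¬ x i ≈ 0#) × (∀ j → sum (λ i → x i * M i j) ≈ 0#)
    rank<rows⇒leftKernel {r} (b , _ , _ , columns) =
      let x , x≉0 , xb≈0 = underdetermined r b
      in x , x≉0 , λ j → span-annihilated x xb≈0 (columns j)

-- An explicit basis of the column space from a nowhere-zero null vector.

module PotentialRank {c ℓ} (R : CommutativeRing c ℓ)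
  {n m} (G : OrientedGraph (suc n) m) where
  open CommutativeRing R hiding (zero)
  open OrientedGraph G
  open LinearAlgebra R
  open RingArithmetic R
  open SpanProperties R
  open SemiringSum semiring using (sum; sum-cong-≋)
  open SemiringSolver commutativeSemiring using (solve; _:+_; _:*_; _:=_; con)
  open SetoidReasoning setoid

  -- Each column of M is a multiple of y_s e_s − y_t e_t, where y = 1/x; by
  -- connectedness these vectors for (s,t) = (k,0) with k ≠ 0 form a basis.
  potential⇒rank :
    WeaklyConnected → (M : Matrix (suc n) m) (α α′ β : Vector Carrier m) →
    (∀ i j → M i j ≈ α j * δ (source j) i + β j * δ (target j) i) →
    (∀ j → α j * α′ j ≈ 1#) →
    (x y : Vector Carrier (suc n)) → (∀ v → x v * y v ≈ 1#) →
    (∀ j → x (source j) * α j + x (target j) * β j ≈ 0#) →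
    HasRank M n
  potential⇒rank connected M α α′ β M≈ αα′≈1 x y xy≈1 null =
    b , independent , b∈columns , columns∈b
    where
    -- These vectors are annihilated by `x` and add up along walks: `d s t + d t u` is `d s u`.
    d : Fin (suc n) → Fin (suc n) → Vector Carrier (suc n)
    d u v i = y u * δ u i + - 1# * (y v * δ v i)

    b : Vector (Vector Carrier (suc n)) n
    b k = d (suc k) zero

    -- Away from coordinate `zero` the family `b` is a diagonal matrix with invertible entries,
    -- whence its independence.
    b-diagonal : ∀ k j → b k (suc j) ≈ y (suc k) * δ j k
    b-diagonal k j = begin
      y (suc k) * δ k j + - 1# * (y zero * 0#)
        ≈⟨ +-cong (*-congˡ (reflexive (δ-sym k j)))
                  (solve 2 (λ n y → n :* (y :* con 0) := con 0) refl (- 1#) (y zero)) ⟩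
      y (suc k) * δ j k + 0#  ≈⟨ +-identityʳ _ ⟩
      y (suc k) * δ j k       ∎

    independent : LinearlyIndependent b
    independent z zb≈0 k = begin
      z k                                   ≈⟨ *-identityʳ _ ⟨
      z k * 1#                              ≈⟨ *-congˡ (xy≈1 (suc k)) ⟨
      z k * (x (suc k) * y (suc k))
        ≈⟨ solve 3 (λ z x y → z :* (x :* y) := x :* (z :* y)) refl (z k) (x (suc k)) (y (suc k)) ⟩
      x (suc k) * (z k * y (suc k))         ≈⟨ *-congˡ zy≈0 ⟩
      x (suc k) * 0#                        ≈⟨ zeroʳ _ ⟩
      0#                                    ∎
      where
      zy≈0 : z k * y (suc k) ≈ 0#
      zy≈0 = begin
        z k * y (suc k)
          ≈⟨ sum-*δ (λ j → z j * y (suc j)) k ⟨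
        sum (λ j → z j * y (suc j) * δ k j)
          ≈⟨ sum-cong-≋ (λ j → trans (*-assoc (z j) _ _) (*-congˡ (sym (b-diagonal j k)))) ⟩
        linearCombination z b (suc k)         ≈⟨ zb≈0 (suc k) ⟩
        0#                                    ∎

    -- Inserting `x v * y v ≈ 1#` at both ends exposes the product `x t * β j`, which the null
    -- equation replaces by `- 1# * (x s * α j)`.
    column≈ : ∀ j i → transpose M j i ≈ α j * x (source j) * d (source j) (target j) i
    column≈ j i = begin
      M i j                  ≈⟨ M≈ i j ⟩
      α j * δs + β j * δt
        ≈⟨ +-cong (unit (α j * δs) (xy≈1 s)) (unit (β j * δt) (xy≈1 t)) ⟩
      α j * δs * (x s * y s) + β j * δt * (x t * y t)
        ≈⟨ solve 8 (λ α β δs δt xs xt ys yt →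
             α :* δs :* (xs :* ys) :+ β :* δt :* (xt :* yt)
             := α :* xs :* (ys :* δs) :+ xt :* β :* (yt :* δt))
             refl (α j) (β j) δs δt (x s) (x t) (y s) (y t) ⟩
      α j * x s * (y s * δs) + x t * β j * (y t * δt)
        ≈⟨ +-congˡ (*-congʳ (x+y≈0⇒y≈-1*x (null j))) ⟩
      α j * x s * (y s * δs) + - 1# * (x s * α j) * (y t * δt)
        ≈⟨ solve 5 (λ α xs p q n → α :* xs :* p :+ n :* (xs :* α) :* q
             := α :* xs :* (p :+ n :* q)) refl (α j) (x s) (y s * δs) (y t * δt) (- 1#) ⟩
      α j * x s * d s t i    ∎
      where
      s = source j
      t = target j
      δs = δ s i
      δt = δ t i
      unit : ∀ z {w} → w ≈ 1# → z ≈ z * w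
      unit z w≈1 = sym (trans (*-congˡ w≈1) (*-identityʳ z))

    -- For a fixed family `v`, membership of `d s t` in its span is an equivalence relation on the
    -- vertices. For the columns it contains adjacency; for `b` it relates every vertex to `zero`.
    -- Each case gives one inclusion of spans.
    module DifferenceSpan {r} (v : Vector (Vector Carrier (suc n)) r) where
      swap : ∀ {s t} → d s t ∈Span v → d t s ∈Span v
      swap {s} {t} st = span-cong (λ i → begin
        - 1# * (y s * δ s i + - 1# * (y t * δ t i))
          ≈⟨ solve 3 (λ n p q → n :* (p :+ n :* q) := (n :* n) :* q :+ n :* p)
               refl (- 1#) (y s * δ s i) (y t * δ t i) ⟩
        - 1# * - 1# * (y t * δ t i) + - 1# * (y s * δ s i)
          ≈⟨ +-congʳ (trans (*-congʳ -1*-1≈1) (*-identityˡ _)) ⟩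
        d t s i ∎) (span-* (- 1#) st)

      diagonal : ∀ s → d s s ∈Span v
      diagonal s = span-cong (λ i → sym (1+-1*x≈0 (y s * δ s i))) span-zero

      compose : ∀ {s t u} → d s t ∈Span v → d t u ∈Span v → d s u ∈Span v
      compose {s} {t} {u} st tu = span-cong (λ i → begin
        d s t i + d t u i
          ≈⟨ solve 4 (λ n p q r → (p :+ n :* q) :+ (q :+ n :* r)
               := (p :+ n :* r) :+ (q :+ n :* q)) refl
               (- 1#) (y s * δ s i) (y t * δ t i) (y u * δ u i) ⟩
        d s u i + (y t * δ t i + - 1# * (y t * δ t i))  ≈⟨ +-congˡ (1+-1*x≈0 _) ⟩
        d s u i + 0#                                    ≈⟨ +-identityʳ _ ⟩
        d s u i                                         ∎) (span-+ st tu)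

    module _ where
      open DifferenceSpan (transpose M)

      -- The coefficient `α j * x s` in `column≈` is a unit with inverse `α′ j * y s`.
      edge∈ : ∀ j → d (source j) (target j) ∈Span transpose M
      edge∈ j = span-cong (λ i → begin
        α′ j * y s * M i j                        ≈⟨ *-congˡ (column≈ j i) ⟩
        α′ j * y s * (α j * x s * d s t i)
          ≈⟨ solve 5 (λ α α′ x y d → α′ :* y :* (α :* x :* d)
               := (α :* α′) :* ((x :* y) :* d)) refl (α j) (α′ j) (x s) (y s) (d s t i) ⟩
        α j * α′ j * (x s * y s * d s t i)
          ≈⟨ *-cong (αα′≈1 j) (*-congʳ (xy≈1 s)) ⟩
        1# * (1# * d s t i)                       ≈⟨ trans (*-identityˡ _) (*-identityˡ _) ⟩
        d s t i                                   ∎)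
        (span-* (α′ j * y s) (span-generator j))
        where
        s = source j
        t = target j

      adjacent∈ : ∀ {u v} → u ~ v → d u v ∈Span transpose M
      adjacent∈ (inj₁ (j , ≡.refl , ≡.refl)) = edge∈ j
      adjacent∈ (inj₂ (j , ≡.refl , ≡.refl)) = swap (edge∈ j)

      walk∈ : ∀ {u v} → Star _~_ u v → d u v ∈Span transpose M
      walk∈ {u} ε       = diagonal u
      walk∈ (u~w ◅ w~v) = compose (adjacent∈ u~w) (walk∈ w~v)

      b∈columns : ∀ k → b k ∈Span transpose M
      b∈columns k = walk∈ (connected (suc k) zero)

    module _ where
      open DifferenceSpan b

      toZero∈ : ∀ u → d u zero ∈Span b
      toZero∈ zero    = diagonal zero
      toZero∈ (suc k) = span-generator k

      columns∈b : ∀ j → transpose M j ∈Span b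
      columns∈b j = span-cong (λ i → sym (column≈ j i))
        (span-* (α j * x (source j)) (compose (toZero∈ (source j)) (swap (toZero∈ (target j)))))

-- Walks as lists: endpoints and splitting at a vertex.

module _ {a} {A : Set a} where

  -- The last vertex of the walk u ∷ l.
  end : A → List A → A
  end = foldl λ _ → id

  end-∈ : ∀ u l → end u l ∈ u ∷ l
  end-∈ u []      = here ≡.refl
  end-∈ u (w ∷ l) = there (end-∈ w l)

  unique-++⁻ : ∀ xs {ys : List A} → Unique (xs ++ ys) →
    Unique xs × Unique ys × (∀ {v} → v ∈ ys → v ∉ xs)
  unique-++⁻ []       uys = [] , uys , λ _ ()
  unique-++⁻ (x ∷ xs) (x∉ ∷ uxsys) with unique-++⁻ xs uxsys | ++⁻ xs x∉
  ... | uxs , uys , disjoint | x∉xs , x∉ys = x∉xs ∷ uxs , uys , λ where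
    v∈ys (here ≡.refl) → All¬⇒¬Any x∉ys v∈ys
    v∈ys (there v∈xs)  → disjoint v∈ys v∈xs

  linked-++⁻ : ∀ {r} {_∼_ : A → A → Set r} xs {v ys} → Linked _∼_ (xs ++ v ∷ ys) →
    Linked _∼_ (xs ∷ʳ v) × Linked _∼_ (v ∷ ys)
  linked-++⁻ []           v∼ys       = [-] , v∼ys
  linked-++⁻ (x ∷ [])     (x∼v ∷ l)  = x∼v ∷ [-] , l
  linked-++⁻ (x ∷ y ∷ xs) (x∼y ∷ l) with linked-++⁻ (y ∷ xs) l
  ... | l₁ , l₂ = x∼y ∷ l₁ , l₂

-- Gain graphs: balance and potentials.

record GainFunction {c ℓ} (R : CommutativeRing c ℓ) {n m} (G : OrientedGraph n m) :
  Set (c ⊔ ℓ) where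
  open CommutativeRing R
  open OrientedGraph G
  field
    σ         : Fin n → Fin n → Carrier
    σ-inverse : ∀ {u v} → u ~ v → σ u v * σ v u ≈ 1#

module GainGraph {c ℓ} {R : CommutativeRing c ℓ} {n m} {G : OrientedGraph n m}
  (gainFunction : GainFunction R G) where
  open CommutativeRing R hiding (zero)
  open OrientedGraph G
  open GainFunction gainFunction
  open RingArithmetic R
  open SemiringSolver commutativeSemiring using (solve; _:+_; _:*_; _:=_)
  open SetoidReasoning setoid

  gain : List (Fin n) → Carrier
  gain []          = 1#
  gain (_ ∷ [])    = 1#
  gain (i ∷ j ∷ γ) = σ i j * gain (j ∷ γ)

  gain-++ : ∀ xs v ys → gain (xs ++ v ∷ ys) ≈ gain (xs ∷ʳ v) * gain (v ∷ ys)
  gain-++ []           v ys = sym (*-identityˡ _)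
  gain-++ (x ∷ [])     v ys = *-congʳ (sym (*-identityʳ _))
  gain-++ (x ∷ y ∷ xs) v ys = trans (*-congˡ (gain-++ (y ∷ xs) v ys)) (sym (*-assoc _ _ _))

  Balanced : Set ℓ
  Balanced = ∀ C → gain (Cycle.closedWalk C) ≈ 1#

  IsPotential : (Fin n → Carrier) → Set ℓ
  IsPotential x = ∀ {u v} → u ~ v → x v ≈ σ u v * x u

  ~⇒≢ : ∀ {u v} → u ~ v → u ≢ v
  ~⇒≢ (inj₁ (e , s≡u , t≡v)) u≡v = loopless e (≡.trans s≡u (≡.trans u≡v (≡.sym t≡v)))
  ~⇒≢ (inj₂ (e , s≡v , t≡u)) u≡v = loopless e (≡.trans s≡v (≡.trans (≡.sym u≡v) (≡.sym t≡u)))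

  potential-along : ∀ {x} → IsPotential x → ∀ u l → Linked _~_ (u ∷ l) →
    x (end u l) ≈ gain (u ∷ l) * x u
  potential-along pot u []      _          = sym (*-identityˡ _)
  potential-along {x} pot u (w ∷ l) (u~w ∷ ls) = begin
    x (end w l)                      ≈⟨ potential-along pot w l ls ⟩
    gain (w ∷ l) * x w               ≈⟨ *-congˡ (pot u~w) ⟩
    gain (w ∷ l) * (σ u w * x u)
      ≈⟨ solve 3 (λ g s x → g :* (s :* x) := s :* g :* x) refl _ _ _ ⟩
    σ u w * gain (w ∷ l) * x u       ∎

  -- Going once around a cycle multiplies the value at `base` by the gain and returns the same
  -- value, which can be cancelled.
  potential⇒balanced : ∀ {x} → IsPotential x → (∀ u → ∃ λ y → x u * y ≈ 1#) → Balanced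
  potential⇒balanced {x} pot invertible C = *-cancelˡ-unit (proj₁ (invertible base))
    (proj₂ (invertible base)) (begin
      x base * gain closedWalk   ≈⟨ *-comm _ _ ⟩
      gain closedWalk * x base   ≈⟨ potential-along pot base (rest ∷ʳ base) closed ⟨
      x (end base (rest ∷ʳ base)) ≡⟨ ≡.cong x (foldl-∷ʳ (λ _ → id) base base rest) ⟩
      x base                     ≈⟨ *-identityʳ _ ⟨
      x base * 1#                ∎)
    where open Cycle C

  -- Used contrapositively: in a connected graph, a potential that is nonzero at one vertex is
  -- nonzero at all of them.
  potential-zero : ∀ {x} → IsPotential x → ∀ {u v} → Star _~_ u v → x u ≈ 0# → x v ≈ 0#
  potential-zero pot ε           xu≈0 = xu≈0
  potential-zero pot (u~w ◅ w~v) xu≈0 =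
    potential-zero pot w~v (trans (pot u~w) (trans (*-congˡ xu≈0) (zeroʳ _)))

  gain★ : ∀ {u v} → Star _~_ u v → Carrier
  gain★ ε                           = 1#
  gain★ (_◅_ {u} {w} u~w w~v) = σ u w * gain★ w~v

  gain★-◅◅ : ∀ {u v w} (p : Star _~_ u v) (q : Star _~_ v w) →
    gain★ (p ◅◅ q) ≈ gain★ p * gain★ q
  gain★-◅◅ ε       q = sym (*-identityˡ _)
  gain★-◅◅ (_ ◅ p) q = trans (*-congˡ (gain★-◅◅ p q)) (sym (*-assoc _ _ _))

  -- The index `g` is the gain of the walk being loop-erased, so the type records that erasure
  -- preserves the gain.
  record SimplePath (u v : Fin n) (g : Carrier) : Set ℓ where
    field
      rest   : List (Fin n)
      unique : Unique (u ∷ rest)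
      linked : Linked _~_ (u ∷ rest)
      ends   : end u rest ≡ v
      gain≈  : gain (u ∷ rest) ≈ g

  module _ (balanced : Balanced) where

    -- A closed walk u, xs, u with distinct vertices is a cycle unless xs has
    -- a single vertex, when it runs through one edge back and forth.
    closed-gain : ∀ {u w} xs → u ~ w → Unique (w ∷ xs) → u ∉ w ∷ xs →
      Linked _~_ (w ∷ xs ∷ʳ u) → gain (u ∷ w ∷ xs ∷ʳ u) ≈ 1#
    closed-gain []        u~w _   _    _      =
      trans (*-congˡ (*-identityʳ _)) (σ-inverse u~w)
    closed-gain (x ∷ xs)  u~w uxs u∉xs linked = balanced record
      { length≥3 = s≤s (s≤s (s≤s z≤n))
      ; unique   = ¬Any⇒All¬ _ u∉xs ∷ uxs
      ; closed   = u~w ∷ linked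
      }

    -- If `u` already lies on the path, the new edge followed by the path up to `u` is a closed walk
    -- without other repetitions. Its gain is 1, so only the part of the path from `u` onwards is
    -- kept.
    extend : ∀ {u w v g} → u ~ w → SimplePath w v g → SimplePath u v (σ u w * g)
    extend {u} {w} {v} {g} u~w P with _∈?_ _≟_ u (w ∷ SimplePath.rest P)
    ... | no u∉ = record
      { rest   = w ∷ rest
      ; unique = ¬Any⇒All¬ _ u∉ ∷ unique
      ; linked = u~w ∷ linked
      ; ends   = ends
      ; gain≈  = *-congˡ gain≈
      }
      where open SimplePath P
    ... | yes u∈ with ∈-∃++ u∈
    -- An empty prefix would mean `u ≡ w`, which is impossible without loops.
    ...   | []     , ys , eq = contradiction (≡.sym (proj₁ (∷-injective eq))) (~⇒≢ u~w)
    ...   | _ ∷ xs , ys , ≡.refl with unique-++⁻ (w ∷ xs) (SimplePath.unique P)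
                                    | linked-++⁻ (w ∷ xs) (SimplePath.linked P)
    ...     | uxs , uys , disjoint | lxs , lys = record
      { rest   = ys
      ; unique = uys
      ; linked = lys
      ; ends   = ≡.trans (≡.sym (foldl-++ (λ _ → id) w xs (u ∷ ys))) ends
      ; gain≈  = begin
          gain (u ∷ ys)                                     ≈⟨ *-identityˡ _ ⟨
          1# * gain (u ∷ ys)
            ≈⟨ *-congʳ (closed-gain xs u~w uxs (disjoint (here ≡.refl)) lxs) ⟨
          gain (u ∷ w ∷ xs ∷ʳ u) * gain (u ∷ ys)            ≈⟨ gain-++ (u ∷ w ∷ xs) u ys ⟨
          σ u w * gain (w ∷ xs ++ u ∷ ys)                   ≈⟨ *-congˡ gain≈ ⟩
          σ u w * g                                         ∎
      }
      where open SimplePath P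

    loopErase : ∀ {u v} (p : Star _~_ u v) → SimplePath u v (gain★ p)
    loopErase ε = record
      { rest = [] ; unique = [] ∷ [] ; linked = [-] ; ends = ≡.refl ; gain≈ = refl }
    loopErase (u~w ◅ p) = extend u~w (loopErase p)

    -- A simple path that ends where it starts is trivial, because its last vertex would otherwise
    -- repeat `u`.
    gain★-closed : ∀ {u} (p : Star _~_ u u) → gain★ p ≈ 1#
    gain★-closed {u} p with loopErase p
    ... | record { rest = [] ; gain≈ = 1≈g } = sym 1≈g
    ... | record { rest = w ∷ l ; unique = u∉ ∷ _ ; ends = ends } =
      contradiction (≡.subst (_∈ w ∷ l) ends (end-∈ w l)) (All¬⇒¬Any u∉)

    -- The potential is the gain of a chosen walk from the root `r`, and its inverse is the gain of
    -- a chosen walk back. Trivial gain on closed walks makes the choices immaterial.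
    balanced⇒potential : Fin n → WeaklyConnected →
      ∃ λ x → IsPotential x × ∃ λ (y : Fin n → Carrier) → ∀ v → x v * y v ≈ 1#
    balanced⇒potential r connected = x , potential , y , xy≈1
      where
      x y : Fin n → Carrier
      x v = gain★ (connected r v)
      y v = gain★ (connected v r)
      xy≈1 : ∀ v → x v * y v ≈ 1#
      xy≈1 v = trans (sym (gain★-◅◅ (connected r v) (connected v r)))
        (gain★-closed (connected r v ◅◅ connected v r))
      potential : IsPotential x
      -- The closed walk from `r` to `u`, across the edge to `v` and back has gain 1, as has the one
      -- through `v` alone; the common return factor `y v` cancels.
      potential {u} {v} u~v = *-cancelˡ-unit (x v) (trans (*-comm _ _) (xy≈1 v)) (begin
        y v * x v               ≈⟨ *-comm _ _ ⟩
        x v * y v               ≈⟨ xy≈1 v ⟩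
        1#                      ≈⟨ gain★-closed (connected r u ◅◅ u~v ◅ connected v r) ⟨
        gain★ (connected r u ◅◅ u~v ◅ connected v r)
          ≈⟨ gain★-◅◅ (connected r u) (u~v ◅ connected v r) ⟩
        x u * (σ u v * y v)
          ≈⟨ solve 3 (λ x s y → x :* (s :* y) := y :* (s :* x)) refl _ _ _ ⟩
        y v * (σ u v * x u)     ∎)

-- Signs and squares of real numbers.

module RealProperties {ℓ} (ℝ : Reals ℓ) where
  open Reals ℝ
  open RealSqrt ℝ
  open RingProperties ring using (-0#≈0#; -‿involutive)

  <⇒≤ : ∀ {x y} → x < y → x ≤ y
  <⇒≤ = proj₁

  <⇒≉0 : ∀ {x} → 0# < x → ¬ x ≈ 0#
  <⇒≉0 (_ , 0≉x) x≈0 = 0≉x (sym x≈0)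

  0<1 : 0# < 1#
  0<1 = 0≤1 , 0≉1

  *-pos : ∀ {x y} → 0# < x → 0# < y → 0# < x * y
  *-pos 0<x 0<y = *-nonneg (<⇒≤ 0<x) (<⇒≤ 0<y)
    , λ 0≈xy → <⇒≉0 0<x (x*y≈0⇒x≈0 (sym 0≈xy) (<⇒≉0 0<y))

  square-injective : ∀ {x y} → 0# ≤ x → 0# ≤ y → x * x ≈ y * y → x ≈ y
  square-injective 0≤x 0≤y xx≈yy = antisym
    (sq-reflects-≤ 0≤y (≤-reflexive xx≈yy)) (sq-reflects-≤ 0≤x (≤-reflexive (sym xx≈yy)))

  x+y≈0⇒x≈0 : ∀ {x y} → 0# ≤ x → 0# ≤ y → x + y ≈ 0# → x ≈ 0#
  x+y≈0⇒x≈0 {x} 0≤x 0≤y x+y≈0 = antisym (≤-respʳ-≈ x+y≈0 (x≤x+d x 0≤y)) 0≤x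

  neg-pos : ∀ {x} → x < 0# → 0# < - x
  neg-pos {x} (x≤0 , x≉0) = ≤0⇒0≤- x≤0 , λ 0≈-x →
    x≉0 (trans (sym (-‿involutive x)) (trans (-‿cong (sym 0≈-x)) -0#≈0#))

  neg-neg : ∀ {x} → 0# < x → - x < 0#
  neg-neg {x} (0≤x , 0≉x) =
    ≤-respˡ-≈ (+-identityˡ (- x)) (≤-respʳ-≈ (-‿inverseʳ x) (+-monoˡ-≤ (- x) 0≤x))
    , λ -x≈0 → 0≉x (trans (sym -0#≈0#) (trans (-‿cong (sym -x≈0)) (-‿involutive x)))

-- Conjugation, modulus, principal roots and unimodular gains in the complex field.

module ComplexProperties {ℓ} (ℝ : Reals ℓ) where
  open Reals ℝ
  open RealSqrt ℝ
  open RealProperties ℝ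
  open Complex ℝ
  open RingProperties ring using (-‿distribˡ-*; -‿distribʳ-*; -‿involutive; -0#≈0#; -‿+-comm)
  private module ℂᴿ = CommutativeRing ℂ-commutativeRing
  open RingArithmetic ℂ-commutativeRing public
  open SemiringSolver ℂᴿ.commutativeSemiring using (solve; _:+_; _:*_; _:=_; con)
  private module Solverᴿ = SemiringSolver commutativeSemiring

  real : Carrier → ℂ
  real x = x +i 0#

  real-cong : ∀ {x y} → x ≈ y → real x ≈ᶜ real y
  real-cong x≈y = mk≈ x≈y refl

  real-* : ∀ x y → real x *ᶜ real y ≈ᶜ real (x * y)
  real-* x y = mk≈
    (trans (+-congˡ (trans (-‿cong (zeroˡ 0#)) -0#≈0#)) (+-identityʳ _))
    (trans (+-cong (zeroʳ x) (zeroˡ y)) (+-identityʳ 0#))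

  conj-* : ∀ z w → conj (z *ᶜ w) ≈ᶜ conj z *ᶜ conj w
  conj-* (a +i b) (c +i d) = mk≈
    (+-congˡ (-‿cong (sym (-x*-y≈x*y b d))))
    (trans (sym (-‿+-comm _ _)) (+-cong (-‿distribʳ-* a d) (-‿distribˡ-* b c)))
    where
    -x*-y≈x*y : ∀ x y → - x * - y ≈ x * y
    -x*-y≈x*y x y = trans (sym (-‿distribˡ-* x (- y)))
      (trans (-‿cong (sym (-‿distribʳ-* x y))) (-‿involutive _))

  conj-cong : ∀ {z w} → z ≈ᶜ w → conj z ≈ᶜ conj w
  conj-cong (mk≈ p q) = mk≈ p (-‿cong q)

  conj-involutive : ∀ z → conj (conj z) ≈ᶜ z
  conj-involutive z = mk≈ refl (-‿involutive _)

  conj≉0 : ∀ {z} → ¬ z ≈ᶜ 0ᶜ → ¬ conj z ≈ᶜ 0ᶜ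
  conj≉0 {z} z≉0 z̄≈0 = z≉0 (ℂᴿ.trans (ℂᴿ.sym (conj-involutive z))
    (ℂᴿ.trans (conj-cong z̄≈0) (mk≈ refl -0#≈0#)))

  norm : ℂ → Carrier
  norm z = re z * re z + im z * im z

  norm-cong : ∀ {z w} → z ≈ᶜ w → norm z ≈ norm w
  norm-cong (mk≈ p q) = +-cong (*-cong p p) (*-cong q q)

  norm-conj : ∀ z → norm (conj z) ≈ norm z
  norm-conj z = +-congˡ (-x*-x≈x*x (im z))

  norm-real : ∀ x → norm (real x) ≈ x * x
  norm-real x = trans (+-congˡ (zeroˡ 0#)) (+-identityʳ _)

  norm-nonneg : ∀ z → 0# ≤ norm z
  norm-nonneg z = +-nonneg (sq-nonneg (re z)) (sq-nonneg (im z))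

  z*conj[z]≈norm : ∀ z → z *ᶜ conj z ≈ᶜ real (norm z)
  z*conj[z]≈norm (a +i b) = mk≈
    (+-congˡ (trans (-‿cong (sym (-‿distribʳ-* b b))) (-‿involutive _)))
    (trans (+-cong (sym (-‿distribʳ-* a b)) (*-comm b a)) (-‿inverseˡ _))

  norm-* : ∀ z w → norm (z *ᶜ w) ≈ norm z * norm w
  norm-* z w = re≈ (begin
    real (norm (z *ᶜ w))              ≈⟨ z*conj[z]≈norm (z *ᶜ w) ⟨
    z *ᶜ w *ᶜ conj (z *ᶜ w)           ≈⟨ ℂᴿ.*-congˡ (conj-* z w) ⟩
    z *ᶜ w *ᶜ (conj z *ᶜ conj w)
      ≈⟨ solve 4 (λ z w z′ w′ → z :* w :* (z′ :* w′) := (z :* z′) :* (w :* w′))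
           ℂᴿ.refl z w (conj z) (conj w) ⟩
    z *ᶜ conj z *ᶜ (w *ᶜ conj w)      ≈⟨ ℂᴿ.*-cong (z*conj[z]≈norm z) (z*conj[z]≈norm w) ⟩
    real (norm z) *ᶜ real (norm w)    ≈⟨ real-* (norm z) (norm w) ⟩
    real (norm z * norm w)            ∎)
    where open SetoidReasoning ℂᴿ.setoid

  norm≈0⇒≈0 : ∀ {z} → norm z ≈ 0# → z ≈ᶜ 0ᶜ
  norm≈0⇒≈0 {z} nz≈0 = mk≈
    (x*x≈0⇒x≈0 (x+y≈0⇒x≈0 (sq-nonneg (re z)) (sq-nonneg (im z)) nz≈0))
    (x*x≈0⇒x≈0 (x+y≈0⇒x≈0 (sq-nonneg (im z)) (sq-nonneg (re z)) (trans (+-comm _ _) nz≈0)))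

  _≟0ᶜ : ∀ z → Dec (z ≈ᶜ 0ᶜ)
  z ≟0ᶜ = map′ (λ (p , q) → mk≈ p q) (λ (mk≈ p q) → p , q) ((re z ≈? 0#) ×-dec (im z ≈? 0#))

  1ᶜ≉0ᶜ : ¬ 1ᶜ ≈ᶜ 0ᶜ
  1ᶜ≉0ᶜ 1≈0 = 0≉1 (sym (re≈ 1≈0))

  inverseᶜ : ∀ {z} → ¬ z ≈ᶜ 0ᶜ → ∃ λ w → z *ᶜ w ≈ᶜ 1ᶜ
  inverseᶜ {z} z≉0 = conj z *ᶜ real (norm z ⁻¹) , (begin
    z *ᶜ (conj z *ᶜ real (norm z ⁻¹))   ≈⟨ ℂᴿ.*-assoc z (conj z) _ ⟨
    z *ᶜ conj z *ᶜ real (norm z ⁻¹)     ≈⟨ ℂᴿ.*-congʳ (z*conj[z]≈norm z) ⟩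
    real (norm z) *ᶜ real (norm z ⁻¹)   ≈⟨ real-* _ _ ⟩
    real (norm z * norm z ⁻¹)           ≈⟨ real-cong (*-inverseʳ _ (z≉0 ∘ norm≈0⇒≈0)) ⟩
    1ᶜ                                  ∎)
    where open SetoidReasoning ℂᴿ.setoid

  √-square : ∀ z → √ z *ᶜ √ z ≈ᶜ z
  √-square z = proj₁ (proj₂ (principalSqrt z))

  -- |z| = |√z|², since norm is the squared modulus.
  abs : ℂ → Carrier
  abs z = norm (√ z)

  abs-nonneg : ∀ z → 0# ≤ abs z
  abs-nonneg z = norm-nonneg (√ z)

  abs-square : ∀ z → abs z * abs z ≈ norm z
  abs-square z = trans (sym (norm-* (√ z) (√ z))) (norm-cong (√-square z))

  -- Two nonnegative reals with the same square agree. The hypothesis is a setoid equality because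
  -- `a v u` is the conjugate of `a u v` only up to `≈ᶜ`.
  abs-conj : ∀ {z w} → w ≈ᶜ conj z → abs w ≈ abs z
  abs-conj {z} {w} w≈z̄ = square-injective (abs-nonneg w) (abs-nonneg z) (begin
    abs w * abs w   ≈⟨ abs-square w ⟩
    norm w          ≈⟨ norm-cong w≈z̄ ⟩
    norm (conj z)   ≈⟨ norm-conj z ⟩
    norm z          ≈⟨ abs-square z ⟨
    abs z * abs z   ∎)
    where open SetoidReasoning setoid

  abs≉0 : ∀ {z} → ¬ z ≈ᶜ 0ᶜ → ¬ abs z ≈ 0#
  abs≉0 {z} z≉0 az≈0 = z≉0 (norm≈0⇒≈0
    (trans (sym (abs-square z)) (trans (*-congʳ az≈0) (zeroˡ _))))

  abs-pos : ∀ {z} → ¬ z ≈ᶜ 0ᶜ → 0# < abs z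
  abs-pos {z} z≉0 = abs-nonneg z , λ 0≈az → abs≉0 z≉0 (sym 0≈az)

  -- A root on the imaginary axis would make `z` minus a real square, hence a negative real.
  √-re-pos : ∀ {z} → ¬ z ≈ᶜ 0ᶜ → ¬ ℝ⁻ z → 0# < re (√ z)
  √-re-pos {z} z≉0 z∉ℝ⁻ with proj₂ (proj₂ (principalSqrt z))
  ... | inj₁ 0<re       = 0<re
  ... | inj₂ (re≈0 , _) = contradiction (neg , im≈0) z∉ℝ⁻
    where
    s = √ z
    re≈-imim : re z ≈ - (im s * im s)
    re≈-imim = trans (sym (re≈ (√-square z)))
      (trans (+-congʳ (trans (*-congʳ re≈0) (zeroˡ _))) (+-identityˡ _))
    im≈0 : im z ≈ 0#
    im≈0 = trans (sym (im≈ (√-square z)))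
      (trans (+-cong (trans (*-congʳ re≈0) (zeroˡ _)) (trans (*-congˡ re≈0) (zeroʳ _)))
        (+-identityˡ 0#))
    neg : re z < 0#
    neg = <-respˡ-≈ (sym re≈-imim) (neg-neg (sq-nonneg (im s)
      , λ 0≈ → z≉0 (mk≈ (trans re≈-imim (trans (-‿cong (sym 0≈)) -0#≈0#)) im≈0)))

  -- Off the branch cut, √ (conj z) and conj (√ z) are square roots of conj z
  -- in the open right half-plane, so their sum does not vanish.
  √-conj : ∀ {z} → ¬ z ≈ᶜ 0ᶜ → ¬ ℝ⁻ z → √ conj z ≈ᶜ conj (√ z)
  √-conj {z} z≉0 z∉ℝ⁻ = ℂᴿ.sym (begin
    t                       ≈⟨ x+y≈0⇒y≈-1*x s-t≈0 ⟩
    -ᶜ 1ᶜ *ᶜ (-ᶜ 1ᶜ *ᶜ s)    ≈⟨ ℂᴿ.*-assoc _ _ s ⟨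
    -ᶜ 1ᶜ *ᶜ -ᶜ 1ᶜ *ᶜ s      ≈⟨ ℂᴿ.*-congʳ -1*-1≈1 ⟩
    1ᶜ *ᶜ s                 ≈⟨ ℂᴿ.*-identityˡ s ⟩
    s                       ∎)
    where
    open SetoidReasoning ℂᴿ.setoid
    s = √ conj z
    t = conj (√ z)
    tt≈ss : t *ᶜ t ≈ᶜ s *ᶜ s
    tt≈ss = ℂᴿ.trans (ℂᴿ.sym (conj-* (√ z) (√ z)))
      (ℂᴿ.trans (conj-cong (√-square z)) (ℂᴿ.sym (√-square (conj z))))
    conj∉ℝ⁻ : ¬ ℝ⁻ (conj z)
    conj∉ℝ⁻ (re<0 , -im≈0) = z∉ℝ⁻ (re<0
      , trans (sym (-‿involutive _)) (trans (-‿cong -im≈0) -0#≈0#))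
    s+t≉0 : ¬ s +ᶜ t ≈ᶜ 0ᶜ
    s+t≉0 s+t≈0 = <⇒≉0 (√-re-pos (conj≉0 z≉0) conj∉ℝ⁻)
      (x+y≈0⇒x≈0 (<⇒≤ (√-re-pos (conj≉0 z≉0) conj∉ℝ⁻)) (<⇒≤ (√-re-pos z≉0 z∉ℝ⁻)) (re≈ s+t≈0))
    -- The product of `s + t` and `t - s` is a difference of equal squares, and `s + t` is
    -- invertible.
    s-t≈0 : -ᶜ 1ᶜ *ᶜ s +ᶜ t ≈ᶜ 0ᶜ
    s-t≈0 = *-cancelˡ-unit (proj₁ (inverseᶜ s+t≉0)) (proj₂ (inverseᶜ s+t≉0)) (begin
      (s +ᶜ t) *ᶜ (-ᶜ 1ᶜ *ᶜ s +ᶜ t)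
        ≈⟨ solve 3 (λ s t n → (s :+ t) :* (n :* s :+ t)
             := (t :* t :+ n :* (s :* s)) :+ (s :* t :+ n :* (s :* t))) ℂᴿ.refl s t (-ᶜ 1ᶜ) ⟩
      (t *ᶜ t +ᶜ -ᶜ 1ᶜ *ᶜ (s *ᶜ s)) +ᶜ (s *ᶜ t +ᶜ -ᶜ 1ᶜ *ᶜ (s *ᶜ t))
        ≈⟨ ℂᴿ.+-cong (ℂᴿ.trans (ℂᴿ.+-congʳ tt≈ss) (1+-1*x≈0 _)) (1+-1*x≈0 _) ⟩
      0ᶜ +ᶜ 0ᶜ               ≈⟨ ℂᴿ.+-identityˡ 0ᶜ ⟩
      0ᶜ                     ≈⟨ ℂᴿ.zeroʳ (s +ᶜ t) ⟨
      (s +ᶜ t) *ᶜ 0ᶜ         ∎)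

  √*√conj≈abs : ∀ {z} → ¬ z ≈ᶜ 0ᶜ → ¬ ℝ⁻ z → √ z *ᶜ √ conj z ≈ᶜ real (abs z)
  √*√conj≈abs {z} z≉0 z∉ℝ⁻ =
    ℂᴿ.trans (ℂᴿ.*-congˡ (√-conj z≉0 z∉ℝ⁻)) (z*conj[z]≈norm (√ z))

  -- This is -z/|z|; the sign comes from solving w x_u + |w| x_v = 0 for x_v.
  unitGain : ℂ → ℂ
  unitGain z = -ᶜ 1ᶜ *ᶜ z *ᶜ real (abs z ⁻¹)

  abs*⁻¹≈1 : ∀ {z} → ¬ z ≈ᶜ 0ᶜ → real (abs z) *ᶜ real (abs z ⁻¹) ≈ᶜ 1ᶜ
  abs*⁻¹≈1 {z} z≉0 = ℂᴿ.trans (real-* _ _) (real-cong (*-inverseʳ (abs z) (abs≉0 z≉0)))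

  polar : ∀ {z} → ¬ z ≈ᶜ 0ᶜ → z ≈ᶜ -ᶜ 1ᶜ *ᶜ (real (abs z) *ᶜ unitGain z)
  polar {z} z≉0 = ℂᴿ.sym (begin
    n *ᶜ (real (abs z) *ᶜ (n *ᶜ z *ᶜ real (abs z ⁻¹)))
      ≈⟨ solve 4 (λ n p z q → n :* (p :* (n :* z :* q)) := (n :* n) :* (p :* q) :* z)
           ℂᴿ.refl n (real (abs z)) z (real (abs z ⁻¹)) ⟩
    n *ᶜ n *ᶜ (real (abs z) *ᶜ real (abs z ⁻¹)) *ᶜ z
      ≈⟨ ℂᴿ.*-congʳ (ℂᴿ.*-cong -1*-1≈1 (abs*⁻¹≈1 z≉0)) ⟩
    1ᶜ *ᶜ 1ᶜ *ᶜ z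
      ≈⟨ ℂᴿ.trans (ℂᴿ.*-assoc 1ᶜ 1ᶜ z) (ℂᴿ.trans (ℂᴿ.*-identityˡ _) (ℂᴿ.*-identityˡ z)) ⟩
    z              ∎)
    where
    open SetoidReasoning ℂᴿ.setoid
    n = -ᶜ 1ᶜ

  norm-unitGain : ∀ {z} → ¬ z ≈ᶜ 0ᶜ → norm (unitGain z) ≈ 1#
  norm-unitGain {z} z≉0 = begin
    norm (-ᶜ 1ᶜ *ᶜ z *ᶜ real i)              ≈⟨ norm-* (-ᶜ 1ᶜ *ᶜ z) (real i) ⟩
    norm (-ᶜ 1ᶜ *ᶜ z) * norm (real i)        ≈⟨ *-cong (norm-* (-ᶜ 1ᶜ) z) (norm-real i) ⟩
    norm (-ᶜ 1ᶜ) * norm z * (i * i)          ≈⟨ *-congʳ (*-cong norm[-1]≈1 (sym (abs-square z))) ⟩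
    1# * (p * p) * (i * i)
      ≈⟨ Solverᴿ.solve 2 (λ p i → con′ 1 *′ (p *′ p) *′ (i *′ i)
           :=′ (p *′ i) *′ (p *′ i)) refl p i ⟩
    (p * i) * (p * i)                        ≈⟨ *-cong pi≈1 pi≈1 ⟩
    1# * 1#                                  ≈⟨ *-identityˡ 1# ⟩
    1#                                       ∎
    where
    open SetoidReasoning setoid
    p = abs z
    i = abs z ⁻¹
    open Solverᴿ using () renaming (con to con′; _:*_ to _*′_; _:=_ to _:=′_)
    pi≈1 : p * i ≈ 1#
    pi≈1 = *-inverseʳ p (abs≉0 z≉0)
    norm[-1]≈1 : norm (-ᶜ 1ᶜ) ≈ 1#
    norm[-1]≈1 = trans (+-cong (trans (-x*-x≈x*x 1#) (*-identityˡ 1#))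
      (trans (-x*-x≈x*x 0#) (zeroˡ 0#))) (+-identityʳ 1#)

  unitGain-conj : ∀ {z w} → ¬ z ≈ᶜ 0ᶜ → w ≈ᶜ conj z → unitGain z *ᶜ unitGain w ≈ᶜ 1ᶜ
  unitGain-conj {z} {w} z≉0 w≈z̄ = begin
    n *ᶜ z *ᶜ i *ᶜ (n *ᶜ w *ᶜ j)
      ≈⟨ solve 5 (λ n z i w j → n :* z :* i :* (n :* w :* j)
           := (n :* n) :* ((z :* w) :* (i :* j))) ℂᴿ.refl n z i w j ⟩
    n *ᶜ n *ᶜ (z *ᶜ w *ᶜ (i *ᶜ j))
      ≈⟨ ℂᴿ.*-cong -1*-1≈1 (ℂᴿ.*-congʳ zw≈pq) ⟩
    1ᶜ *ᶜ (p *ᶜ q *ᶜ (i *ᶜ j))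
      ≈⟨ solve 4 (λ p q i j → con 1 :* (p :* q :* (i :* j)) := (p :* i) :* (q :* j)) ℂᴿ.refl p q i j ⟩
    p *ᶜ i *ᶜ (q *ᶜ j)            ≈⟨ ℂᴿ.*-cong (abs*⁻¹≈1 z≉0) (abs*⁻¹≈1 w≉0) ⟩
    1ᶜ *ᶜ 1ᶜ                      ≈⟨ ℂᴿ.*-identityˡ 1ᶜ ⟩
    1ᶜ                            ∎
    where
    open SetoidReasoning ℂᴿ.setoid
    n = -ᶜ 1ᶜ
    i = real (abs z ⁻¹)
    j = real (abs w ⁻¹)
    p = real (abs z)
    q = real (abs w)
    w≉0 : ¬ w ≈ᶜ 0ᶜ
    w≉0 w≈0 = conj≉0 z≉0 (ℂᴿ.trans (ℂᴿ.sym w≈z̄) w≈0)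
    zw≈pq : z *ᶜ w ≈ᶜ p *ᶜ q
    zw≈pq = begin
      z *ᶜ w                 ≈⟨ ℂᴿ.*-congˡ w≈z̄ ⟩
      z *ᶜ conj z            ≈⟨ z*conj[z]≈norm z ⟩
      real (norm z)
        ≈⟨ real-cong (trans (sym (abs-square z)) (*-congˡ (sym (abs-conj w≈z̄)))) ⟩
      real (abs z * abs w)   ≈⟨ real-* _ _ ⟨
      p *ᶜ q                 ∎

  ℝ⁺-cong : ∀ {z w} → z ≈ᶜ w → ℝ⁺ z → ℝ⁺ w
  ℝ⁺-cong (mk≈ p q) (0<re , im≈0) = <-respʳ-≈ p 0<re , trans (sym q) im≈0

  ℝ⁻-cong : ∀ {z w} → z ≈ᶜ w → ℝ⁻ z → ℝ⁻ w
  ℝ⁻-cong (mk≈ p q) (re<0 , im≈0) = <-respˡ-≈ p re<0 , trans (sym q) im≈0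

  ℝ⁺-neg : ∀ {z} → ℝ⁺ z → ℝ⁻ (-ᶜ z)
  ℝ⁺-neg (0<re , im≈0) = neg-neg 0<re , trans (-‿cong im≈0) -0#≈0#

  ℝ⁻-neg : ∀ {z} → ℝ⁻ z → ℝ⁺ (-ᶜ z)
  ℝ⁻-neg (re<0 , im≈0) = neg-pos re<0 , trans (-‿cong im≈0) -0#≈0#

  -- Taking norms, the positive real `t g` has the same square as `t`, so it equals `t`.
  unimodular-positive⇒≈1 : ∀ {t g} → 0# < t → norm g ≈ 1# → ℝ⁺ (real t *ᶜ g) → g ≈ᶜ 1ᶜ
  unimodular-positive⇒≈1 {t} {g} 0<t ng≈1 (0<r , im≈0) =
    *-cancelˡ-unit (real (t ⁻¹))
      (ℂᴿ.trans (real-* t (t ⁻¹)) (real-cong (*-inverseʳ t (<⇒≉0 0<t))))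
      (ℂᴿ.trans tg≈r (ℂᴿ.trans (real-cong (sym t≈r)) (ℂᴿ.sym (ℂᴿ.*-identityʳ (real t)))))
    where
    open SetoidReasoning setoid
    r = re (real t *ᶜ g)
    tg≈r : real t *ᶜ g ≈ᶜ real r
    tg≈r = mk≈ refl im≈0
    t≈r : t ≈ r
    t≈r = square-injective (<⇒≤ 0<t) (<⇒≤ 0<r) (begin
      t * t                   ≈⟨ *-identityʳ _ ⟨
      t * t * 1#              ≈⟨ *-cong (norm-real t) ng≈1 ⟨
      norm (real t) * norm g  ≈⟨ norm-* (real t) g ⟨
      norm (real t *ᶜ g)      ≈⟨ norm-cong tg≈r ⟩
      norm (real r)           ≈⟨ norm-real r ⟩
      r * r                   ∎)

  sign : ℕ → ℂ
  sign zero    = 1ᶜ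
  sign (suc k) = -ᶜ 1ᶜ *ᶜ sign k

  sign-+2 : ∀ k → sign (suc (suc k)) ≈ᶜ sign k
  sign-+2 k = ℂᴿ.trans (ℂᴿ.sym (ℂᴿ.*-assoc _ _ _))
    (ℂᴿ.trans (ℂᴿ.*-congʳ -1*-1≈1) (ℂᴿ.*-identityˡ _))

  sign-parity : ∀ k → (2 ∣ k × sign k ≈ᶜ 1ᶜ) ⊎ (¬ 2 ∣ k × sign k ≈ᶜ -ᶜ 1ᶜ)
  sign-parity zero          = inj₁ (2 ∣0 , ℂᴿ.refl)
  sign-parity (suc zero)    = inj₂ ((λ 2∣1 → contradiction (∣1⇒≡1 2∣1) λ ()) , ℂᴿ.*-identityʳ _)
  sign-parity (suc (suc k)) with sign-parity k
  ... | inj₁ (2∣k , s≈) = inj₁ (∣m∣n⇒∣m+n ∣-refl 2∣k , ℂᴿ.trans (sign-+2 k) s≈)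
  ... | inj₂ (2∤k , s≈) = inj₂ ((λ 2∣k+2 → 2∤k (∣m+n∣m⇒∣n 2∣k+2 ∣-refl)) , ℂᴿ.trans (sign-+2 k) s≈)

-- Gains of the weighted graph, cycle weights and null vectors of the incidence matrix.

module IncidenceRank {ℓ} (ℝ : Reals ℓ) {n m}
  (G : Weighted.WeightedOrientedGraph ℝ n m) where
  open Weighted ℝ
  open WeightedOrientedGraph G
  open Reals ℝ using (_<_; _⁻¹)
    renaming (0# to 0ᴿ; 1# to 1ᴿ; _≈_ to _≈ᴿ_; _*_ to _*ᴿ_;
              *-cong to *ᴿ-cong; *-identityˡ to *ᴿ-identityˡ; trans to transᴿ)
  open Complex ℝ
  open RealProperties ℝ using (0<1; *-pos)
  open ComplexProperties ℝ
  open LinearAlgebra ℂ-commutativeRing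
  open SpanProperties ℂ-commutativeRing
  open CommutativeRing ℂ-commutativeRing hiding (zero)
  open RingProperties ring using (-1*x≈-x; -‿involutive)
  open SemiringSum semiring using (sum; sum-cong-≋)
  open SemiringSolver commutativeSemiring using (solve; _:+_; _:*_; _:=_)
  open SetoidReasoning setoid

  -- The search inside `a` may return another edge with the same ends; `distinct` identifies it with
  -- `e`.
  a-edge : ∀ e → a (source e) (target e) ≡ weight e
  a-edge e with source e ⟶? target e | target e ⟶? source e
  ... | yes (f , s≡ , t≡) | _ = ≡.cong weight (distinct f e s≡ t≡)
  ... | no s↛t            | _ = contradiction (e , ≡.refl , ≡.refl) s↛t

  a-conj : ∀ {u v} → u ~ v → a v u ≈ conj (a u v)
  a-conj {u} {v} u~v with u ⟶? v | v ⟶? u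
  ... | yes (e , se≡u , te≡v) | yes (f , sf≡v , tf≡u) =
    contradiction (≡.trans te≡v (≡.sym sf≡v)) (oriented e f (≡.trans se≡u (≡.sym tf≡u)))
  ... | yes _   | no _    = refl
  ... | no _    | yes _   = sym (conj-involutive _)
  ... | no u↛v  | no v↛u  = contradiction u~v [ u↛v , v↛u ]′

  a≉0 : ∀ {u v} → u ~ v → ¬ a u v ≈ 0ᶜ
  a≉0 = [ forward , (λ v⟶u auv≈0 →
    conj≉0 (forward v⟶u) (trans (sym (a-conj (inj₁ v⟶u))) auv≈0)) ]′
    where
    forward : ∀ {u v} → u ⟶ v → ¬ a u v ≈ 0ᶜ
    forward (e , ≡.refl , ≡.refl) = ≡.subst (λ z → ¬ z ≈ 0ᶜ) (≡.sym (a-edge e)) (weight≉0 e)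

  σ : Fin n → Fin n → ℂ
  σ u v = unitGain (a u v)

  σ-inverse : ∀ {u v} → u ~ v → σ u v * σ v u ≈ 1ᶜ
  σ-inverse u~v = unitGain-conj (a≉0 u~v) (a-conj u~v)

  gainFunction : GainFunction ℂ-commutativeRing orientedGraph
  gainFunction = record { σ = σ ; σ-inverse = σ-inverse }

  open GainGraph gainFunction

  -- By `polar`, each step contributes a factor -1, a modulus and a gain; `t` collects the moduli.
  wt≈gain : ∀ i γ → Linked _~_ (i ∷ γ) → ∃ λ t → 0ᴿ < t ×
    wt (i ∷ γ) ≈ sign (List.length γ) * (real t * gain (i ∷ γ))
  wt≈gain i []      _            = _ , 0<1 , sym (trans (*-identityˡ _) (*-identityˡ _))
  wt≈gain i (j ∷ γ) (i~j ∷ j∷γ) with wt≈gain j γ j∷γ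
  ... | t , 0<t , wt≈ = abs (a i j) *ᴿ t , *-pos (abs-pos (a≉0 i~j)) 0<t , (begin
    a i j * wt (j ∷ γ)                            ≈⟨ *-cong (polar (a≉0 i~j)) wt≈ ⟩
    - 1# * (real (abs (a i j)) * σ i j) * (s * (real t * g))
      ≈⟨ solve 6 (λ n p u s t g → n :* (p :* u) :* (s :* (t :* g))
           := n :* s :* ((p :* t) :* (u :* g))) refl (- 1#) (real (abs (a i j))) (σ i j) s (real t) g ⟩
    - 1# * s * (real (abs (a i j)) * real t * (σ i j * g))
      ≈⟨ *-congˡ (*-congʳ (real-* _ _)) ⟩
    - 1# * s * (real (abs (a i j) *ᴿ t) * (σ i j * g))  ∎)
    where
    s = sign (List.length γ)
    g = gain (j ∷ γ)

  norm-gain : ∀ γ → Linked _~_ γ → norm (gain γ) ≈ᴿ 1ᴿ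
  norm-gain []          _           = transᴿ (norm-real 1ᴿ) (*ᴿ-identityˡ 1ᴿ)
  norm-gain (i ∷ [])    _           = transᴿ (norm-real 1ᴿ) (*ᴿ-identityˡ 1ᴿ)
  norm-gain (i ∷ j ∷ γ) (i~j ∷ j∷γ) = transᴿ (norm-* (σ i j) (gain (j ∷ γ)))
    (transᴿ (*ᴿ-cong (norm-unitGain (a≉0 i~j)) (norm-gain (j ∷ γ) j∷γ)) (*ᴿ-identityˡ 1ᴿ))

  CycleSigns : Set ℓ
  CycleSigns = (∀ C → Even C → ℝ⁺ (wtCycle C)) × (∀ C → Odd C → ℝ⁻ (wtCycle C))

  wtCycle≈gain : ∀ C → ∃ λ t → 0ᴿ < t ×
    wtCycle C ≈ sign (Cycle.length C) * (real t * gain (Cycle.closedWalk C))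
  wtCycle≈gain C = ≡.subst
    (λ k → ∃ λ t → 0ᴿ < t × wtCycle C ≈ sign k * (real t * gain closedWalk))
    -- The closed walk has as many edges as the cycle has vertices: the repeated `base` at the end
    -- makes up for the first vertex, which starts no count.
    (≡.trans (length-++ rest) (ℕ.+-comm _ 1)) (wt≈gain base (rest ∷ʳ base) closed)
    where open Cycle C

  sign-even : ∀ {k z w} → z ≈ sign k * w → sign k ≈ 1# → z ≈ w
  sign-even z≈ s≈1 = trans z≈ (trans (*-congʳ s≈1) (*-identityˡ _))

  sign-odd : ∀ {k z w} → z ≈ sign k * w → sign k ≈ - 1# → z ≈ - w
  sign-odd z≈ s≈-1 = trans z≈ (trans (*-congʳ s≈-1) (-1*x≈-x _))

  balanced⇒cycleSigns : Balanced → CycleSigns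
  balanced⇒cycleSigns balanced = even , odd
    where
    positive : ∀ {t} C → 0ᴿ < t → ℝ⁺ (real t * gain (Cycle.closedWalk C))
    positive {t} C 0<t = ℝ⁺-cong (sym (trans (*-congˡ (balanced C)) (*-identityʳ (real t))))
      (0<t , Reals.refl ℝ)
    even : ∀ C → Even C → ℝ⁺ (wtCycle C)
    even C 2∣k with wtCycle≈gain C | sign-parity (Cycle.length C)
    ... | t , 0<t , wt≈ | inj₁ (_ , s≈1) =
      ℝ⁺-cong (sym (sign-even {Cycle.length C} wt≈ s≈1)) (positive C 0<t)
    ... | _             | inj₂ (2∤k , _) = contradiction 2∣k 2∤k
    odd : ∀ C → Odd C → ℝ⁻ (wtCycle C)
    odd C 2∤k with wtCycle≈gain C | sign-parity (Cycle.length C)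
    ... | t , 0<t , wt≈ | inj₂ (_ , s≈-1) =
      ℝ⁻-cong (sym (sign-odd {Cycle.length C} wt≈ s≈-1)) (ℝ⁺-neg (positive C 0<t))
    ... | _             | inj₁ (2∣k , _)  = contradiction 2∣k 2∤k

  -- The parity sign cancels the prescribed sign of the weight, leaving a positive multiple of the
  -- gain that is itself a positive real; a unimodular gain must then be 1.
  cycleSigns⇒balanced : CycleSigns → Balanced
  cycleSigns⇒balanced (even , odd) C with wtCycle≈gain C | sign-parity (Cycle.length C)
  ... | t , 0<t , wt≈ | inj₁ (2∣k , s≈1) =
    unimodular-positive⇒≈1 0<t (norm-gain _ (Cycle.closed C))
      (ℝ⁺-cong (sign-even {Cycle.length C} wt≈ s≈1) (even C 2∣k))
  ... | t , 0<t , wt≈ | inj₂ (2∤k , s≈-1) =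
    unimodular-positive⇒≈1 0<t (norm-gain _ (Cycle.closed C))
      (ℝ⁺-cong (trans (-‿cong (sign-odd {Cycle.length C} wt≈ s≈-1)) (-‿involutive _))
        (ℝ⁻-neg (odd C 2∤k)))

  -- `N` tests the source first; looplessness guarantees that at most one of the two terms survives.
  N≈ : ∀ i j → N i j ≈ √ weight j * δ (source j) i + √ conj (weight j) * δ (target j) i
  N≈ i j with i ≟ source j | i ≟ target j
  ... | yes ≡.refl | _ = sym (trans
    (+-cong (trans (*-congˡ (reflexive (δ-refl i))) (*-identityʳ _))
            (trans (*-congˡ (reflexive (δ-≢ (loopless j ∘ ≡.sym)))) (zeroʳ _)))
    (+-identityʳ _))
  ... | no i≢s | yes ≡.refl = sym (trans
    (+-cong (trans (*-congˡ (reflexive (δ-≢ (i≢s ∘ ≡.sym)))) (zeroʳ _))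
            (trans (*-congˡ (reflexive (δ-refl i))) (*-identityʳ _)))
    (+-identityˡ _))
  ... | no i≢s | no i≢t = sym (trans
    (+-cong (trans (*-congˡ (reflexive (δ-≢ (i≢s ∘ ≡.sym)))) (zeroʳ _))
            (trans (*-congˡ (reflexive (δ-≢ (i≢t ∘ ≡.sym)))) (zeroʳ _)))
    (+-identityʳ _))

  IsNull : (Fin n → ℂ) → Set ℓ
  IsNull x = ∀ j → x (source j) * √ weight j + x (target j) * √ conj (weight j) ≈ 0ᶜ

  sum-*-N : ∀ x j → sum (λ i → x i * N i j) ≈
    x (source j) * √ weight j + x (target j) * √ conj (weight j)
  sum-*-N x j = begin
    sum (λ i → x i * N i j)
      ≈⟨ sum-cong-≋ (λ i → *-congˡ (N≈ i j)) ⟩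
    sum (λ i → x i * (α * δ (source j) i + β * δ (target j) i))
      ≈⟨ sum-*-linear x (λ i → α * δ (source j) i) (δ (target j)) β ⟩
    sum (λ i → x i * (α * δ (source j) i)) + β * sum (λ i → x i * δ (target j) i)
      ≈⟨ +-cong (sum-cong-≋ (λ i → sym (*-assoc (x i) α _))) (*-congˡ (sum-*δ x (target j))) ⟩
    sum (λ i → x i * α * δ (source j) i) + β * x (target j)
      ≈⟨ +-cong (sum-*δ (λ i → x i * α) (source j)) (*-comm β _) ⟩
    x (source j) * α + x (target j) * β  ∎
    where
    α = √ weight j
    β = √ conj (weight j)

  module _ (weight∉ℝ⁻ : ∀ e → ¬ ℝ⁻ (weight e)) where

    module Edge (e : Fin m) where
      w = weight e
      α = √ w
      β = √ conj w
      p = real (abs w)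
      i = real (abs w ⁻¹)

      αβ≈p : α * β ≈ p
      αβ≈p = √*√conj≈abs (weight≉0 e) (weight∉ℝ⁻ e)

      pi≈1 : p * i ≈ 1#
      pi≈1 = abs*⁻¹≈1 (weight≉0 e)

      α-inverse : α * (β * i) ≈ 1#
      α-inverse = trans (sym (*-assoc α β i)) (trans (*-congʳ αβ≈p) pi≈1)

      -- Multiplying by the unit `α` removes the square roots from the null equation without losing
      -- information.
      scaled : ∀ x y → α * (x * α + y * β) ≈ w * x + p * y
      scaled x y = begin
        α * (x * α + y * β)
          ≈⟨ solve 4 (λ α β x y → α :* (x :* α :+ y :* β) := (α :* α) :* x :+ (α :* β) :* y)
               refl α β x y ⟩
        α * α * x + α * β * y    ≈⟨ +-cong (*-congʳ (√-square w)) (*-congʳ αβ≈p) ⟩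
        w * x + p * y            ∎

      p*σ : ∀ x → p * (unitGain w * x) ≈ - 1# * (w * x)
      p*σ x = begin
        p * (- 1# * w * i * x)
          ≈⟨ solve 5 (λ p n w i x → p :* (n :* w :* i :* x) := (p :* i) :* (n :* (w :* x)))
               refl p (- 1#) w i x ⟩
        p * i * (- 1# * (w * x))  ≈⟨ trans (*-congʳ pi≈1) (*-identityˡ _) ⟩
        - 1# * (w * x)            ∎

      null⇒step : ∀ {x y} → x * α + y * β ≈ 0ᶜ → y ≈ unitGain w * x
      null⇒step {x} {y} null = *-cancelˡ-unit i pi≈1 (begin
        p * y
          ≈⟨ x+y≈0⇒y≈-1*x (trans (sym (scaled x y)) (trans (*-congˡ null) (zeroʳ α))) ⟩
        - 1# * (w * x)       ≈⟨ p*σ x ⟨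
        p * (unitGain w * x) ∎)

      step⇒null : ∀ {x y} → y ≈ unitGain w * x → x * α + y * β ≈ 0ᶜ
      step⇒null {x} {y} step = *-cancelˡ-unit (β * i) α-inverse (begin
        α * (x * α + y * β)         ≈⟨ scaled x y ⟩
        w * x + p * y               ≈⟨ +-congˡ (trans (*-congˡ step) (p*σ x)) ⟩
        w * x + - 1# * (w * x)      ≈⟨ 1+-1*x≈0 (w * x) ⟩
        0ᶜ                          ≈⟨ zeroʳ α ⟨
        α * 0ᶜ                      ∎)

    null⇒potential : ∀ {x} → IsNull x → IsPotential x
    null⇒potential {x} null = step
      where
      forward : ∀ {u v} → u ⟶ v → x v ≈ σ u v * x u
      forward (e , ≡.refl , ≡.refl) =
        ≡.subst (λ z → x (target e) ≈ unitGain z * x (source e)) (≡.sym (a-edge e))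
          (Edge.null⇒step e (null e))
      step : IsPotential x
      step {u} {v} (inj₁ u⟶v) = forward u⟶v
      -- Against the orientation, the relation along the edge is inverted by the reverse gain.
      step {u} {v} (inj₂ v⟶u) = begin
        x v                          ≈⟨ *-identityˡ _ ⟨
        1# * x v                     ≈⟨ *-congʳ (σ-inverse (inj₂ v⟶u)) ⟨
        σ u v * σ v u * x v          ≈⟨ *-assoc _ _ _ ⟩
        σ u v * (σ v u * x v)        ≈⟨ *-congˡ (forward v⟶u) ⟨
        σ u v * x u                  ∎

    potential⇒null : ∀ {x} → IsPotential x → IsNull x
    potential⇒null {x} pot e = Edge.step⇒null e
      (≡.subst (λ z → x (target e) ≈ unitGain z * x (source e)) (a-edge e)
        (pot (inj₁ (e , ≡.refl , ≡.refl))))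

    leftKernel⇒balanced : WeaklyConnected → ∀ {x : Fin n → ℂ} {u} → ¬ x u ≈ 0ᶜ →
      (∀ j → sum (λ i → x i * N i j) ≈ 0ᶜ) → Balanced
    leftKernel⇒balanced connected {x} {u} xu≉0 xN≈0 = potential⇒balanced potential
      (λ v → inverseᶜ (xu≉0 ∘ potential-zero potential (connected v u)))
      where
      potential : IsPotential x
      potential = null⇒potential (λ j → trans (sym (sum-*-N x j)) (xN≈0 j))

-- The equivalence between the rank and the cycle signs.

open import Data.Nat using (_≤_; _∸_)

theorem2p6 :
    ∀ {ℓ} (ℝ : Reals ℓ) →
    let open Complex ℝ
        open LinearAlgebra ℂ-commutativeRing
        open Weighted ℝ in
    ∀ {n m} → 2 ≤ n → 1 ≤ m →
    (G : WeightedOrientedGraph n m) →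
    let open WeightedOrientedGraph G in
    WeaklyConnected →
    (∀ e → ¬ ℝ⁻ (weight e)) →
    HasRank N (n ∸ 1) ⇔
      (IsTree ⊎
        ((∀ C → Even C → ℝ⁺ (wtCycle C)) × (∀ C → Odd C → ℝ⁻ (wtCycle C))))
-- Matching `n` with a successor makes `n ∸ 1` reduce to `r` and supplies the vertex `zero` as a
-- root.
theorem2p6 ℝ {ℕ.suc r} {m} (s≤s _) _ G connected weight∉ℝ⁻ = mk⇔ to from
  where
  open Complex ℝ
  open LinearAlgebra ℂ-commutativeRing
  open Weighted ℝ
  open WeightedOrientedGraph G
  open ComplexProperties ℝ
  open IncidenceRank ℝ G
  open FieldLinearAlgebra ℂ-commutativeRing
  open GainGraph gainFunction
  open PotentialRank ℂ-commutativeRing orientedGraph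

  -- For a tree the sign conditions hold vacuously, so the second alternative covers every case.
  to : HasRank N r → IsTree ⊎ CycleSigns
  to rank = let x , (u , xu≉0) , xN≈0 = rank<rows⇒leftKernel 1ᶜ≉0ᶜ _≟0ᶜ inverseᶜ rank in
    inj₂ (balanced⇒cycleSigns (leftKernel⇒balanced weight∉ℝ⁻ connected {x} {u} xu≉0 xN≈0))

  balanced⇒rank : Balanced → HasRank N r
  balanced⇒rank balanced =
    let x , potential , y , xy≈1 = balanced⇒potential balanced zero connected in
    -- The inverse of √w is √(conj w)/|w|, as the two roots multiply to |w|.
    potential⇒rank connected N (λ e → √ weight e) (λ e → √ conj (weight e) *ᶜ Edge.i weight∉ℝ⁻ e)
      (λ e → √ conj (weight e)) N≈ (Edge.α-inverse weight∉ℝ⁻)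
      x y xy≈1 (potential⇒null weight∉ℝ⁻ potential)

  from : IsTree ⊎ CycleSigns → HasRank N r
  -- Without cycles, balance is vacuous.
  from (inj₁ (_ , acyclic)) = balanced⇒rank (λ C → contradiction C acyclic)
  from (inj₂ signs)         = balanced⇒rank (cycleSigns⇒balanced signs)
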